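{- Let $D$ be a lock diagram with nonempty rows $r_1<r_2<\dots<r_n$. Suppose that there is at most one index $k$ with $r_k>k$ such that row $r_k$ of $\mathsf{snow}(D)$ contains no dark cloud. Then $\mathrm{MaxG}(D)$ equals the number of snowflakes in $\mathsf{snow}^*(D)$.
   Context: A diagram is a finite set of cells at positions $(r,c)$ with $r,c$ positive integers ($r$ = row from the bottom, $c$ = column), at most one cell per position; each cell is either ordinary, written $(r,c)$, or a ghost cell, written $\langle r,c\rangle$. A position is empty if it contains no cell. K-Kohnert move at row $r$ of $D$: let the rightmost cell of row $r$ (ghost or not) lie in column $c$. The move does nothing if that cell is a ghost cell, or every position $(r',c)$ with $r'<r$ is occupied, or, letting $\hat r<r$ be maximal with $(\hat r,c)$ empty, some $(r^*,c)$ with $\hat r<r^*<r$ holds a ghost cell. Otherwise there are two choices: the Kohnert move moves the cell from $(r,c)$ to $(\hat r,c)$; the ghost move does the same and additionally places a ghost cell $\langle r,c\rangle$ at $(r,c)$. $KKD(D)$ is the set of $D$ and all diagrams obtained from $D$ by finite sequences of K-Kohnert moves; $\mathrm{MaxG}(D)$ is the maximum number of ghost cells in a diagram of $KKD(D)$. Snow diagram $\mathsf{snow}(D)$: for $D$ with no ghost cells, process rows from top to bottom; in each row mark the rightmost cell of that row with no already-marked cell above it in its column (if any); marked cells are dark clouds. Place a snowflake in each empty position strictly below a dark cloud in the same column. $\mathsf{snow}^*(D)$ is obtained from $\mathsf{snow}(D)$ by removing all snowflakes lying in rows that are nonempty in $D$. Lock diagram: for a weak composition $\alpha=(\alpha_1,\dots,\alpha_n)\in\mathbb{Z}_{\ge0}^n$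 with $N=\max_i\alpha_i$, the lock diagram is $\bigcup_{i=1}^n\{(i,N-j):0\le j\le\alpha_i-1\}$ (ordinary cells; row $i$ has $\alpha_i$ cells right-justified ending in column $N$). -}

module Defs where

open import Data.Nat using (ℕ; zero; suc; _+_; _∸_; _≤_; _<_; _⊔_; _≡ᵇ_; _<ᵇ_)
open import Data.Bool using (Bool; true; false; if_then_else_; _∧_; _∨_; not)
open import Data.List using (List; []; _∷_; length; foldr; map; filter; upTo; lookup)
open import Data.Bool.ListAction using (any)
open import Data.Nat.ListAction using (sum)
open import Data.List.Relation.Unary.Unique.Propositional using (Unique)
open import Data.List.Membership.Propositional using (_∈_)
open import Data.Maybe using (Maybe; just; nothing)
open import Data.Product using (Σ; _×_; _,_; ∃) public
open import Data.Fin using (Fin; toℕ)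
open import Relation.Binary.PropositionalEquality using (_≡_; _≢_)
open import Relation.Binary.Construct.Closure.ReflexiveTransitive using (Star)

-- Diagrams.  A diagram assigns to each position (r , c) (row r from the
-- bottom, column c; only r , c ≥ 1 are meaningful positions) either
-- nothing, an ordinary cell, or a ghost cell.

data Cell : Set where
  emp : Cell
  ord : Cell
  gh  : Cell

Diagram : Set
Diagram = ℕ → ℕ → Cell

isEmp : Cell → Bool
isEmp emp = true
isEmp ord = false
isEmp gh  = false

set : Diagram → ℕ → ℕ → Cell → Diagram
set D r c x i j = if (i ≡ᵇ r) ∧ (j ≡ᵇ c) then x else D i j

Rightmost : Diagram → ℕ → ℕ → Set
Rightmost D r c = (D r c ≢ emp) × (∀ c' → c < c' → D r c' ≡ emp)

-- the move at row r is possible: the rightmost cell of row r is an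
-- ordinary cell in column c, rh (with 1 ≤ rh < r) is the maximal empty
-- position below it in column c, and no position strictly between rh and
-- r holds a ghost (i.e. all of them hold ordinary cells).
MoveData : Diagram → ℕ → ℕ → ℕ → Set
MoveData D r c rh =
  Rightmost D r c × (D r c ≡ ord) × (1 ≤ rh) × (rh < r) × (D rh c ≡ emp) ×
  (∀ r* → rh < r* → r* < r → D r* c ≡ ord)

kohnertMove : Diagram → ℕ → ℕ → ℕ → Diagram
kohnertMove D r c rh = set (set D r c emp) rh c ord

ghostMove : Diagram → ℕ → ℕ → ℕ → Diagram
ghostMove D r c rh = set (set D r c gh) rh c ord

data KStep (D : Diagram) : Diagram → Set where
  kohnert : ∀ r c rh → MoveData D r c rh → KStep D (kohnertMove D r c rh)
  ghost   : ∀ r c rh → MoveData D r c rh → KStep D (ghostMove D r c rh)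

InKKD : Diagram → Diagram → Set
InKKD D D' = Star KStep D D'

GhostCount : Diagram → ℕ → Set
GhostCount D k =
  Σ (List (ℕ × ℕ)) λ ps →
    Unique ps × (∀ i j → ((i , j) ∈ ps → D i j ≡ gh) × (D i j ≡ gh → (i , j) ∈ ps))
    × length ps ≡ k

MaxGIs : Diagram → ℕ → Set
MaxGIs D m =
  (Σ Diagram λ D' → InKKD D D' × GhostCount D' m) ×
  (∀ D' k → InKKD D D' → GhostCount D' k → k ≤ m)

-- Snow diagrams, for a ghost-free diagram all of whose cells lie in
-- rows 1..H and columns 1..W.

_∈ᵇ_ : ℕ → List ℕ → Bool
n ∈ᵇ xs = any (λ x → n ≡ᵇ x) xs

pickCol : Diagram → ℕ → List ℕ → ℕ → Maybe ℕ
pickCol D r marked zero = nothing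
pickCol D r marked (suc c) =
  if not (isEmp (D r (suc c))) ∧ not (suc c ∈ᵇ marked)
  then just (suc c) else pickCol D r marked c

-- process rows r, r-1, ..., 1 (top to bottom); `marked` = columns already
-- holding a dark cloud (necessarily above the current row)
cloudsFrom : Diagram → ℕ → ℕ → List ℕ → List (ℕ × ℕ)
cloudsFrom D W zero marked = []
cloudsFrom D W (suc r) marked with pickCol D (suc r) marked W
... | nothing = cloudsFrom D W r marked
... | just c  = (suc r , c) ∷ cloudsFrom D W r (c ∷ marked)

darkClouds : ℕ → ℕ → Diagram → List (ℕ × ℕ)
darkClouds H W D = cloudsFrom D W H []

rowNonemptyᵇ : ℕ → Diagram → ℕ → Bool
rowNonemptyᵇ W D r = any (λ c → not (isEmp (D r c))) (map suc (upTo W))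

snowflakeᵇ : ℕ → ℕ → Diagram → ℕ → ℕ → Bool
snowflakeᵇ H W D r c =
  isEmp (D r c) ∧ any (λ p → (Data.Product.proj₂ p ≡ᵇ c) ∧ (r <ᵇ Data.Product.proj₁ p)) (darkClouds H W D)

snowflake*ᵇ : ℕ → ℕ → Diagram → ℕ → ℕ → Bool
snowflake*ᵇ H W D r c = snowflakeᵇ H W D r c ∧ not (rowNonemptyᵇ W D r)

count : List Bool → ℕ
count = foldr (λ b n → if b then suc n else n) 0

-- number of snowflakes in snow*(D) (all snowflakes lie in rows 1..H,
-- columns 1..W, since dark clouds do)
numSnow* : ℕ → ℕ → Diagram → ℕ
numSnow* H W D =
  sum (map (λ r → count (map (λ c → snowflake*ᵇ H W D r c) (map suc (upTo W))))
           (map suc (upTo H)))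

-- Lock diagrams.  α = (α₁,…,αₙ) given as a list; α i (1-indexed).

nth : List ℕ → ℕ → ℕ
nth [] _ = 0
nth (x ∷ xs) zero = x
nth (x ∷ xs) (suc i) = nth xs i

maxList : List ℕ → ℕ
maxList = foldr _⊔_ 0

lock : List ℕ → Diagram
lock α zero c = emp
lock α (suc i) c =
  if (maxList α ∸ nth α i <ᵇ c) ∧ (c <ᵇ suc (maxList α)) then ord else emp

nonemptyRows : ℕ → ℕ → Diagram → List ℕ
nonemptyRows H W D = filter (λ r → Data.Bool._≟_ (rowNonemptyᵇ W D r) true) (map suc (upTo H))

NoCloudInRow : ℕ → ℕ → Diagram → ℕ → Set
NoCloudInRow H W D r = ∀ c → (r , c) ∈ darkClouds H W D → Data.Empty.⊥
  where import Data.Empty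

AtMostOneBad : ℕ → ℕ → Diagram → Set
AtMostOneBad H W D =
  ∀ (k k' : Fin (length rs)) →
    (suc (toℕ k) < lookup rs k) → NoCloudInRow H W D (lookup rs k) →
    (suc (toℕ k') < lookup rs k') → NoCloudInRow H W D (lookup rs k') →
    k ≡ k'
  where rs = nonemptyRows H W D

-- Label each cell by the row it starts in, relabelling so that the cells of a column never change
-- their order.  Then a label is never lower in a column than in the columns to its right, and each
-- ghost inherits the label of the cell that left it; ghosts of one row have distinct labels, since
-- a ghost is created only when its label is already below that row everywhere further right.  As
-- label ρ stays at or above row rank ρ (the number of nonempty rows up to ρ), it leaves at most
-- ρ − rank ρ ghosts, and clouds contribute exactly ρ − rank ρ snowflakes each.  If there is a bad
-- row B, all rows above it are clouds, and the ghosts with labels ≥ B are redistributed: those with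
-- label ρ in a column right of the cloud of ρ lie in the column of the cloud of a later row k, where
-- together they fit between row rank k and the row reached by label k, which row k leaves unused.
-- Conversely, emptying the rows from bottom to top and each row from right to left, with ghost moves
-- for the clouds only, attains the bound.
module Submission where

open import Defs
open import Algebra.Properties.CommutativeSemigroup using (interchange; xy∙z≈xz∙y)
open import Data.Bool as Bool using (Bool; true; false; T; if_then_else_; _∧_; _∨_; not)
open import Data.Bool.ListAction using (any)
open import Data.Bool.Properties using (∧-zeroʳ)
open import Data.Empty using (⊥-elim)
open import Data.Fin as Fin using (Fin; toℕ)
open import Data.List as List using (List; []; _∷_; _++_; applyUpTo; concat; filter; length; map; upTo)
open import Data.List.Membership.Propositional using (_∈_; find; lose)
open import Data.List.Membership.Propositional.Properties
  using (∈-map⁺; ∈-map⁻; ∈-upTo⁺; ∈-upTo⁻; ∈-∃++; ∈-++⁻; ∈-++⁺ˡ; ∈-++⁺ʳ; ∈-concat⁺′; ∈-concat⁻′)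
open import Data.List.Properties using (length-++; length-++-sucʳ; length-map; length-upTo; map-++; map-upTo; upTo-∷ʳ)
open import Data.List.Relation.Unary.All using (All; []; _∷_; tabulate; lookup; universal)
import Data.List.Relation.Unary.All.Properties as All
open import Data.List.Relation.Unary.AllPairs as AllPairs using (AllPairs; []; _∷_)
import Data.List.Relation.Unary.AllPairs.Properties as AllPairs
open import Data.List.Relation.Unary.Any using (Any; here; there; any?)
open import Data.List.Relation.Unary.Unique.Propositional using (Unique)
open import Data.List.Relation.Unary.Unique.Propositional.Properties using (concat⁺; map⁺; upTo⁺)
open import Data.Maybe using (just; nothing)
open import Data.Nat using (ℕ; zero; suc; pred; _+_; _∸_; _≤_; _<_; _≡ᵇ_; _<ᵇ_; z≤n; s≤s; s≤s⁻¹)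
open import Data.Nat.ListAction using (sum)
open import Data.Nat.ListAction.Properties using (sum-++)
open import Data.Nat.Properties
open import Data.Product using (proj₁; proj₂)
open import Data.Product.Properties using (≡-dec)
open import Data.List.Membership.DecPropositional (≡-dec _≟_ _≟_) using (_∈?_)
open import Data.Sum using (_⊎_; inj₁; inj₂)
open import Data.Unit using (tt)
open import Relation.Binary.Construct.Closure.ReflexiveTransitive using (ε; _◅_; _◅◅_)
open import Relation.Binary.Definitions using (tri<; tri≈; tri>)
open import Relation.Binary.PropositionalEquality using (_≡_; _≢_; refl; sym; trans; cong; cong₂; subst; module ≡-Reasoning)
open import Relation.Nullary using (¬_; Dec; yes; no; contradiction)
open import Relation.Nullary.Decidable using (map′; _×-dec_; _⊎-dec_; ¬?)

-- Booleans, cells and membership tests.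

≡true⇒T : ∀ {b} → b ≡ true → T b
≡true⇒T refl = tt

T⇒≡true : ∀ {b} → T b → b ≡ true
T⇒≡true {true} _ = refl

true≢false : ∀ {b : Bool} → b ≡ true → b ≢ false
true≢false refl ()

emp≢ord : ∀ {x : Cell} → x ≡ emp → x ≢ ord
emp≢ord refl ()

emp≢gh : ∀ {x : Cell} → x ≡ emp → x ≢ gh
emp≢gh refl ()

ord≢gh : ∀ {x : Cell} → x ≡ ord → x ≢ gh
ord≢gh refl ()

any-true⁻ : ∀ {A : Set} (p : A → Bool) xs → any p xs ≡ true → ∃ λ x → x ∈ xs × p x ≡ true
any-true⁻ p (x ∷ xs) h with p x in eq
... | true = x , here refl , eq
... | false with y , y∈ , py ← any-true⁻ p xs h = y , there y∈ , py

any-true⁺ : ∀ {A : Set} (p : A → Bool) {x xs} → x ∈ xs → p x ≡ true → any p xs ≡ true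
any-true⁺ p (here refl) px rewrite px = refl
any-true⁺ p {xs = y ∷ ys} (there x∈) px with p y
... | true = refl
... | false = any-true⁺ p x∈ px

∈ᵇ⇒∈ : ∀ n xs → (n ∈ᵇ xs) ≡ true → n ∈ xs
∈ᵇ⇒∈ n xs h with x , x∈ , e ← any-true⁻ (n ≡ᵇ_) xs h =
  subst (_∈ xs) (sym (≡ᵇ⇒≡ n x (≡true⇒T e))) x∈

∈⇒∈ᵇ : ∀ n {xs} → n ∈ xs → (n ∈ᵇ xs) ≡ true
∈⇒∈ᵇ n n∈ = any-true⁺ (n ≡ᵇ_) n∈ (T⇒≡true (≡⇒≡ᵇ n n refl))

range⁺ : ∀ {c W} → 1 ≤ c → c ≤ W → c ∈ map suc (upTo W)
range⁺ (s≤s _) c≤W = ∈-map⁺ suc (∈-upTo⁺ c≤W)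

range⁻ : ∀ {c W} → c ∈ map suc (upTo W) → (1 ≤ c) × (c ≤ W)
range⁻ c∈ with _ , i∈ , refl ← ∈-map⁻ suc c∈ = s≤s z≤n , ∈-upTo⁻ i∈

-- Dark clouds of an arbitrary diagram.

Occupied : Diagram → ℕ → ℕ → Set
Occupied D r c = isEmp (D r c) ≡ false

extend-marked : ∀ D r m {W b} → (Occupied D r (suc W) → suc W ∈ m) →
  (∀ c → b < c → c ≤ W → Occupied D r c → c ∈ m) →
  ∀ c → b < c → c ≤ suc W → Occupied D r c → c ∈ m
extend-marked D r m new old c b<c c≤ o with m≤n⇒m<n∨m≡n c≤
... | inj₁ c< = old c b<c (s≤s⁻¹ c<) o
... | inj₂ refl = new o

pickCol-just : ∀ D r m W {c} → pickCol D r m W ≡ just c →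
  (1 ≤ c) × (c ≤ W) × Occupied D r c × ¬ (c ∈ m) ×
  (∀ c' → c < c' → c' ≤ W → Occupied D r c' → c' ∈ m)
pickCol-just D r m (suc W) eq with isEmp (D r (suc W)) in e | (suc W ∈ᵇ m) in e'
pickCol-just D r m (suc W) refl | false | false =
  s≤s z≤n , ≤-refl , e , (λ w → true≢false (∈⇒∈ᵇ _ w) e') , (λ c' l l' → contradiction l' (<⇒≱ l))
... | true | _ with p , q , o , n , f ← pickCol-just D r m W eq =
  p , m≤n⇒m≤1+n q , o , n , extend-marked D r m (λ o' → contradiction o' (true≢false e)) f
... | false | true with p , q , o , n , f ← pickCol-just D r m W eq =
  p , m≤n⇒m≤1+n q , o , n , extend-marked D r m (λ _ → ∈ᵇ⇒∈ _ m e') f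

pickCol-nothing : ∀ D r m W → pickCol D r m W ≡ nothing →
  ∀ c → 0 < c → c ≤ W → Occupied D r c → c ∈ m
pickCol-nothing D r m zero eq c l l' o = contradiction (≤-trans l l') λ ()
pickCol-nothing D r m (suc W) eq with isEmp (D r (suc W)) in e | (suc W ∈ᵇ m) in e'
... | true | _ = extend-marked D r m (λ o → contradiction o (true≢false e)) (pickCol-nothing D r m W eq)
... | false | true = extend-marked D r m (λ _ → ∈ᵇ⇒∈ _ m e') (pickCol-nothing D r m W eq)

module _ (D : Diagram) (W : ℕ) where

  cloud-bounds : ∀ n m {r c} → (r , c) ∈ cloudsFrom D W n m →
    (r ≤ n) × (1 ≤ c) × (c ≤ W) × Occupied D r c
  cloud-bounds (suc n) m x with pickCol D (suc n) m W in eq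
  ... | nothing with p , q ← cloud-bounds n m x = m≤n⇒m≤1+n p , q
  cloud-bounds (suc n) m (here refl) | just c with p , q , o , _ ← pickCol-just D _ m W eq =
    ≤-refl , p , q , o
  cloud-bounds (suc n) m (there x) | just c with p , q ← cloud-bounds n (c ∷ m) x =
    m≤n⇒m≤1+n p , q

  cloud-fresh : ∀ n m {r c} → (r , c) ∈ cloudsFrom D W n m → ¬ (c ∈ m)
  cloud-fresh (suc n) m x with pickCol D (suc n) m W in eq
  ... | nothing = cloud-fresh n m x
  cloud-fresh (suc n) m (here refl) | just c with _ , _ , _ , f , _ ← pickCol-just D _ m W eq = f
  cloud-fresh (suc n) m (there x) | just c = λ c∈ → cloud-fresh n (c ∷ m) x (there c∈)

  cloud-row-injective : ∀ n m {r c c'} →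
    (r , c) ∈ cloudsFrom D W n m → (r , c') ∈ cloudsFrom D W n m → c ≡ c'
  cloud-row-injective (suc n) m x y with pickCol D (suc n) m W in eq
  ... | nothing = cloud-row-injective n m x y
  cloud-row-injective (suc n) m (here refl) (here refl) | just c = refl
  cloud-row-injective (suc n) m (here refl) (there y) | just c =
    contradiction (proj₁ (cloud-bounds n (c ∷ m) y)) 1+n≰n
  cloud-row-injective (suc n) m (there x) (here refl) | just c =
    contradiction (proj₁ (cloud-bounds n (c ∷ m) x)) 1+n≰n
  cloud-row-injective (suc n) m (there x) (there y) | just c = cloud-row-injective n (c ∷ m) x y

  clouds-distinct-columns : ∀ n m →
    AllPairs (λ p q → proj₂ p ≢ proj₂ q) (cloudsFrom D W n m)
  clouds-distinct-columns zero m = []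
  clouds-distinct-columns (suc n) m with pickCol D (suc n) m W
  ... | nothing = clouds-distinct-columns n m
  ... | just c = tabulate (λ x e → cloud-fresh n (c ∷ m) x (here (sym e)))
               ∷ clouds-distinct-columns n (c ∷ m)

  -- `pickCol` scans from the right and stops at the first unmarked cell, so a cell of the row is at
  -- or left of the pick, or was found marked. The alternative `c ∈ m` serves the induction and is
  -- void for `m = []`.
  occupied-cloud : ∀ n m {r c} → 1 ≤ r → r ≤ n → 1 ≤ c → c ≤ W → Occupied D r c →
    (∃ λ c' → (r , c') ∈ cloudsFrom D W n m × c ≤ c') ⊎
    (∃ λ k → (k , c) ∈ cloudsFrom D W n m × r < k) ⊎ (c ∈ m)
  occupied-cloud zero m l l' _ _ _ = contradiction (≤-trans l l') λ ()
  occupied-cloud (suc n) m {r} {c} 1≤r r≤n 1≤c c≤W o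
    with pickCol D (suc n) m W in eq | m≤n⇒m<n∨m≡n r≤n
  ... | nothing | inj₂ refl = inj₂ (inj₂ (pickCol-nothing D _ m W eq c 1≤c c≤W o))
  ... | nothing | inj₁ r<n = occupied-cloud n m 1≤r (s≤s⁻¹ r<n) 1≤c c≤W o
  ... | just d | inj₁ r<n with occupied-cloud n (d ∷ m) 1≤r (s≤s⁻¹ r<n) 1≤c c≤W o
  ...   | inj₁ (c' , x , l) = inj₁ (c' , there x , l)
  ...   | inj₂ (inj₁ (k , x , l)) = inj₂ (inj₁ (k , there x , l))
  ...   | inj₂ (inj₂ (here refl)) = inj₂ (inj₁ (suc n , here refl , r<n))
  ...   | inj₂ (inj₂ (there y)) = inj₂ (inj₂ y)
  occupied-cloud (suc n) m {r} {c} 1≤r r≤n 1≤c c≤W o | just d | inj₂ refl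
    with d <? c
  ... | no d≮c = inj₁ (d , here refl , ≮⇒≥ d≮c)
  ... | yes d<c with _ , _ , _ , _ , f ← pickCol-just D _ m W eq = inj₂ (inj₂ (f c d<c c≤W o))

-- Arithmetic, counting by injection, finite sums.

-- Eliminates the common slot `m` and target rank `k` when two shifted ghosts are charged to the
-- same place.
exchange : ∀ m {r r' a a' k} → m + a ≡ r + k → m + a' ≡ r' + k → r + a' ≡ r' + a
exchange m {r} {r'} {a} {a'} {k} p p' = +-cancelʳ-≡ k _ _
  (trans (xy∙z≈xz∙y +-commutativeSemigroup r a' k) (trans (cong (_+ a') (sym p)) (trans (xy∙z≈xz∙y +-commutativeSemigroup m a a')
    (trans (cong (_+ a) p') (xy∙z≈xz∙y +-commutativeSemigroup r' k a)))))

-- Pigeonhole for a relation: the partner of `x` need not be a function of `x`. Each used `y` is cut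
-- out of `ys`, and injectivity keeps later partners away from it.
length-injection : ∀ {A B : Set} (R : A → B → Set) →
  (∀ {x x' y} → R x y → R x' y → x ≡ x') → ∀ {xs} ys → Unique xs →
  (∀ {x} → x ∈ xs → ∃ λ y → y ∈ ys × R x y) → length xs ≤ length ys
length-injection R inj {[]} ys u f = z≤n
length-injection R inj {x ∷ xs} ys (x∉ ∷ u) f with f (here refl)
... | y , y∈ , r with ∈-∃++ y∈
...   | us , vs , refl =
  subst (suc (length xs) ≤_) (sym (length-++-sucʳ us y vs))
    (s≤s (length-injection R inj (us ++ vs) u avoid))
  where
  avoid : ∀ {x'} → x' ∈ xs → ∃ λ y' → y' ∈ us ++ vs × R x' y'
  avoid x'∈ with f (there x'∈)
  ... | y' , y'∈ , r' with ∈-++⁻ us y'∈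
  ...   | inj₁ w = y' , ∈-++⁺ˡ w , r'
  ...   | inj₂ (here refl) = contradiction (inj r r') (lookup x∉ x'∈)
  ...   | inj₂ (there w) = y' , ∈-++⁺ʳ us w , r'

∑ : (ℕ → ℕ) → ℕ → ℕ
∑ f zero = 0
∑ f (suc n) = ∑ f n + f (suc n)

∑-cong : ∀ {f g} n → (∀ i → 1 ≤ i → i ≤ n → f i ≡ g i) → ∑ f n ≡ ∑ g n
∑-cong zero h = refl
∑-cong (suc n) h = cong₂ _+_ (∑-cong n (λ i l l' → h i l (m≤n⇒m≤1+n l'))) (h (suc n) (s≤s z≤n) ≤-refl)

∑-+ : ∀ f g n → ∑ (λ i → f i + g i) n ≡ ∑ f n + ∑ g n
∑-+ f g zero = refl
∑-+ f g (suc n) = trans (cong (_+ (f (suc n) + g (suc n))) (∑-+ f g n))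
  (interchange +-commutativeSemigroup (∑ f n) (∑ g n) (f (suc n)) (g (suc n)))

∑-zero : ∀ {f} n → (∀ i → 1 ≤ i → i ≤ n → f i ≡ 0) → ∑ f n ≡ 0
∑-zero zero h = refl
∑-zero (suc n) h = cong₂ _+_ (∑-zero n (λ i l l' → h i l (m≤n⇒m≤1+n l'))) (h (suc n) (s≤s z≤n) ≤-refl)

δ : ℕ → ℕ → ℕ → ℕ
δ d x c = if d ≡ᵇ c then x else 0

δ-hit : ∀ d x → δ d x d ≡ x
δ-hit d x rewrite T⇒≡true (≡⇒≡ᵇ d d refl) = refl

δ-miss : ∀ d x {c} → d ≢ c → δ d x c ≡ 0
δ-miss d x {c} ne with d ≡ᵇ c in e
... | true = contradiction (≡ᵇ⇒≡ d c (≡true⇒T e)) ne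
... | false = refl

∑-δ : ∀ {d} x n → 1 ≤ d → d ≤ n → ∑ (δ d x) n ≡ x
∑-δ x zero l l' = contradiction (≤-trans l l') λ ()
∑-δ {d} x (suc n) l l' with m≤n⇒m<n∨m≡n l'
... | inj₁ l'' = trans (cong₂ _+_ (∑-δ x n l (s≤s⁻¹ l'')) (δ-miss d x (<⇒≢ l''))) (+-identityʳ x)
... | inj₂ refl = cong₂ _+_ (∑-zero n (λ i _ a → δ-miss d x (λ e → <⇒≢ (s≤s a) (sym e)))) (δ-hit d x)

bit : Bool → ℕ
bit true = 1
bit false = 0

range-suc : ∀ n → map suc (upTo (suc n)) ≡ map suc (upTo n) ++ suc n ∷ []
range-suc n = trans (cong (map suc) (sym (upTo-∷ʳ n))) (map-++ suc (upTo n) (n ∷ []))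

sum-range : ∀ f n → sum (map f (map suc (upTo n))) ≡ ∑ f n
sum-range f zero = refl
sum-range f (suc n) = trans (cong (λ xs → sum (map f xs)) (range-suc n))
  (trans (cong sum (map-++ f (map suc (upTo n)) _))
    (trans (sum-++ (map f (map suc (upTo n))) _) (cong₂ _+_ (sum-range f n) (+-identityʳ _))))

count-map : ∀ {A : Set} (b : A → Bool) xs → count (map b xs) ≡ sum (map (λ x → bit (b x)) xs)
count-map b [] = refl
count-map b (x ∷ xs) with b x
... | true = cong suc (count-map b xs)
... | false = count-map b xs

-- Moves as updates of a diagram.

set-here : ∀ D r c x → set D r c x r c ≡ x
set-here D r c x rewrite T⇒≡true (≡⇒≡ᵇ r r refl) | T⇒≡true (≡⇒≡ᵇ c c refl) = refl

set-away : ∀ D r c x {i j} → ¬ (i ≡ r × j ≡ c) → set D r c x i j ≡ D i j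
set-away D r c x {i} {j} ne with (i ≡ᵇ r) in e | (j ≡ᵇ c) in e'
... | true | true = contradiction (≡ᵇ⇒≡ i r (≡true⇒T e) , ≡ᵇ⇒≡ j c (≡true⇒T e')) ne
... | true | false = refl
... | false | _ = refl

move : Diagram → ℕ → ℕ → ℕ → Cell → Diagram
move D r c r̂ g = set (set D r c g) r̂ c ord

move-landing : ∀ D r c r̂ g → move D r c r̂ g r̂ c ≡ ord
move-landing D r c r̂ g = set-here (set D r c g) r̂ c ord

move-source : ∀ D r c r̂ g → r̂ < r → move D r c r̂ g r c ≡ g
move-source D r c r̂ g l =
  trans (set-away (set D r c g) r̂ c ord (λ (e , _) → <⇒≢ l (sym e))) (set-here D r c g)

move-other : ∀ D r c r̂ g {i j} → ¬ (i ≡ r × j ≡ c) → ¬ (i ≡ r̂ × j ≡ c) → move D r c r̂ g i j ≡ D i j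
move-other D r c r̂ g ne ne' =
  trans (set-away (set D r c g) r̂ c ord ne') (set-away D r c g ne)

-- What a move leaves at its source, so that one argument over `g` covers Kohnert moves and ghost
-- moves.
data Trace : Cell → Set where
  vacated : Trace emp
  haunted : Trace gh

trace≢ord : ∀ {g} → Trace g → g ≢ ord
trace≢ord vacated ()
trace≢ord haunted ()

move-step : ∀ D r c r̂ {g} → Trace g → MoveData D r c r̂ → KStep D (move D r c r̂ g)
move-step D r c r̂ vacated md = kohnert r c r̂ md
move-step D r c r̂ haunted md = ghost r c r̂ md

-- Since the column below is empty, each move drops the cell by a single row. The condition on cells
-- jumped over is then vacuous, and every row left behind keeps a `g`.
walk : ∀ {g} → Trace g → ∀ n {D k t c} → n + k ≡ t → 1 ≤ k → D t c ≡ ord →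
  (∀ i j → k < i → i ≤ t → c < j → D i j ≡ emp) →
  (∀ i → k ≤ i → i < t → D i c ≡ emp) →
  ∃ λ D' → InKKD D D' × D' k c ≡ ord × (∀ i → k < i → i ≤ t → D' i c ≡ g) ×
    (∀ i j → ¬ (j ≡ c × k ≤ i × i ≤ t) → D' i j ≡ D i j)
walk tr zero {D} refl _ o _ _ =
  D , ε , o , (λ i l l' → contradiction l (≤⇒≯ l')) , λ _ _ _ → refl
walk {g} tr (suc n) {D} {k} {c = c} refl 1≤k o right below
  with D' , st , o' , trail , frame ← walk tr n {move D (suc (n + k)) c (n + k) g} {k} {n + k} {c}
         refl 1≤k (move-landing D (suc (n + k)) c (n + k) g)
         (λ i j l l' c<j → trans
           (move-other D (suc (n + k)) c (n + k) g (λ (_ , e) → <⇒≢ c<j (sym e)) (λ (_ , e) → <⇒≢ c<j (sym e)))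
           (right i j l (m≤n⇒m≤1+n l') c<j))
         (λ i l l' → trans
           (move-other D (suc (n + k)) c (n + k) g (λ (e , _) → <⇒≢ (m≤n⇒m≤1+n l') e) (λ (e , _) → <⇒≢ l' e))
           (below i l (m≤n⇒m≤1+n l'))) =
  D' , move-step D _ c _ tr md ◅ st , o' , trail' , frame'
  where
  md : MoveData D (suc (n + k)) c (n + k)
  md = ((λ e → emp≢ord e o) , λ j l → right _ j (s≤s (m≤n+m k n)) ≤-refl l) , o ,
    ≤-trans 1≤k (m≤n+m k n) , ≤-refl , below _ (m≤n+m k n) ≤-refl ,
    λ r l l' → contradiction l (≤⇒≯ (s≤s⁻¹ l'))
  trail' : ∀ i → k < i → i ≤ suc (n + k) → D' i c ≡ g
  trail' i l l' with m≤n⇒m<n∨m≡n l'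
  ... | inj₁ l'' = trail i l (s≤s⁻¹ l'')
  ... | inj₂ refl = trans (frame i c (λ (_ , _ , x) → 1+n≰n x)) (move-source D (suc (n + k)) c (n + k) g ≤-refl)
  frame' : ∀ i j → ¬ (j ≡ c × k ≤ i × i ≤ suc (n + k)) → D' i j ≡ D i j
  frame' i j out = trans (frame i j (λ (e , a , b) → out (e , a , m≤n⇒m≤1+n b)))
    (move-other D (suc (n + k)) c (n + k) g
      (λ { (refl , e) → out (e , m≤n⇒m≤1+n (m≤n+m k n) , ≤-refl) })
      (λ { (refl , e) → out (e , m≤n+m k n , n≤1+n _) }))

-- A move that jumps over cells is read as every cell in rows r̂ + 1 … r going down by one row.
lower : ℕ → ℕ → ℕ → ℕ
lower r̂ r x with r̂ <? x | x ≤? r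
... | yes _ | yes _ = pred x
... | _ | _ = x

data Lowered (r̂ r x : ℕ) : ℕ → Set where
  down : ∀ {y} → r̂ < x → x ≤ r → suc y ≡ x → Lowered r̂ r x y
  stay : ¬ (r̂ < x × x ≤ r) → Lowered r̂ r x x

lowered : ∀ r̂ r x → Lowered r̂ r x (lower r̂ r x)
lowered r̂ r x with r̂ <? x | x ≤? r
lowered r̂ r (suc x) | yes p | yes q = down p q refl
lowered r̂ r zero | yes () | _
... | yes p | no q = stay λ (_ , l) → q l
... | no p | _ = stay λ (l , _) → p l

lowered≤ : ∀ {r̂ r x y} → Lowered r̂ r x y → y ≤ x
lowered≤ (down _ _ refl) = n≤1+n _
lowered≤ (stay _) = ≤-refl

-- Lock diagrams, their clouds and the rank of a row.

module Lock (α : List ℕ) where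

  H W : ℕ
  H = length α
  W = maxList α

  D₀ : Diagram
  D₀ = lock α

  nonempty : ℕ → Bool
  nonempty = rowNonemptyᵇ W D₀

  Nonempty : ℕ → Set
  Nonempty r = nonempty r ≡ true

  -- The `k`-th nonempty row has rank `k`, so the condition that its index exceeds `k` reads
  -- `rank r < r`.
  rank : ℕ → ℕ
  rank zero = 0
  rank (suc r) = if nonempty (suc r) then suc (rank r) else rank r

  Present : ℕ → ℕ → Set
  Present r c = D₀ r c ≡ ord

  Cloud : ℕ → ℕ → Set
  Cloud r c = (r , c) ∈ darkClouds H W D₀

  present-bounds : ∀ i c → Present (suc i) c → (W ∸ nth α i < c) × (c ≤ W)
  present-bounds i c p with (W ∸ nth α i <ᵇ c) in e | (c <ᵇ suc W) in e'
  ... | true | true = <ᵇ⇒< _ c (≡true⇒T e) , s≤s⁻¹ (<ᵇ⇒< c _ (≡true⇒T e'))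

  present-intro : ∀ i c → W ∸ nth α i < c → c ≤ W → Present (suc i) c
  present-intro i c l l'
    rewrite T⇒≡true (<⇒<ᵇ l) | T⇒≡true (<⇒<ᵇ (s≤s l')) = refl

  emp⊎present : ∀ r c → (D₀ r c ≡ emp) ⊎ Present r c
  emp⊎present zero c = inj₁ refl
  emp⊎present (suc i) c with (W ∸ nth α i <ᵇ c) ∧ (c <ᵇ suc W)
  ... | true = inj₂ refl
  ... | false = inj₁ refl

  no-ghost : ∀ r c → D₀ r c ≢ gh
  no-ghost r c e with emp⊎present r c
  ... | inj₁ x = emp≢gh x e
  ... | inj₂ p = ord≢gh p e

  absent⇒emp : ∀ r c → ¬ Present r c → D₀ r c ≡ emp
  absent⇒emp r c np with emp⊎present r c
  ... | inj₁ e = e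
  ... | inj₂ p = contradiction p np

  occupied⇒present : ∀ r c → Occupied D₀ r c → Present r c
  occupied⇒present r c o with emp⊎present r c
  ... | inj₁ e = contradiction (trans (sym o) (cong isEmp e)) λ ()
  ... | inj₂ p = p

  present⇒occupied : ∀ r c → Present r c → Occupied D₀ r c
  present⇒occupied r c p rewrite p = refl

  -- Right-justification, the property of lock diagrams on which both bounds rest.
  present-upward : ∀ r {c c'} → Present r c → c ≤ c' → c' ≤ W → Present r c'
  present-upward (suc i) {c} {c'} p l l' with b , _ ← present-bounds i c p =
    present-intro i c' (<-≤-trans b l) l'

  nth-beyond : ∀ xs i → length xs ≤ i → nth xs i ≡ 0
  nth-beyond [] i l = refl
  nth-beyond (x ∷ xs) (suc i) (s≤s l) = nth-beyond xs i l

  present⇒row≤H : ∀ r c → Present r c → r ≤ H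
  present⇒row≤H (suc i) c p with i <? H | present-bounds i c p
  ... | yes i<H | _ = i<H
  ... | no i≮H | b , c≤W =
    contradiction (≤-trans (subst (λ z → W ∸ z < c) (nth-beyond α i (≮⇒≥ i≮H)) b) c≤W) 1+n≰n

  present⇒1≤row : ∀ r c → Present r c → 1 ≤ r
  present⇒1≤row (suc r) c p = s≤s z≤n

  present⇒1≤col : ∀ r c → Present r c → 1 ≤ c
  present⇒1≤col (suc i) c p = m<n⇒0<n (proj₁ (present-bounds i c p))

  present⇒col≤W : ∀ r c → Present r c → c ≤ W
  present⇒col≤W (suc i) c p = proj₂ (present-bounds i c p)

  present⇒nonempty : ∀ r c → Present r c → Nonempty r
  present⇒nonempty r c p =
    any-true⁺ (λ c → not (isEmp (D₀ r c)))
      (range⁺ (present⇒1≤col r c p) (present⇒col≤W r c p)) (cong (λ x → not (isEmp x)) p)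

  nonempty⇒present : ∀ r → Nonempty r → Present r W
  nonempty⇒present r h
    with c , c∈ , e ← any-true⁻ (λ c → not (isEmp (D₀ r c))) _ h
    with emp⊎present r c
  ... | inj₂ p = present-upward r p (proj₂ (range⁻ c∈)) ≤-refl
  ... | inj₁ x = contradiction (cong (λ x → not (isEmp x)) x) (true≢false e)

  nonempty⇒bounds : ∀ r → Nonempty r → (1 ≤ r) × (r ≤ H)
  nonempty⇒bounds r h with p ← nonempty⇒present r h = present⇒1≤row r W p , present⇒row≤H r W p

  cloud⇒present : ∀ {r c} → Cloud r c → Present r c
  cloud⇒present {r} {c} x with _ , _ , _ , o ← cloud-bounds D₀ W H [] x = occupied⇒present r c o

  cloud⇒nonempty : ∀ {r c} → Cloud r c → Nonempty r
  cloud⇒nonempty {r} {c} x = present⇒nonempty r c (cloud⇒present x)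

  cloud-unique-col : ∀ {r c c'} → Cloud r c → Cloud r c' → c ≡ c'
  cloud-unique-col = cloud-row-injective D₀ W H []

  cloud-unique-row : ∀ {r r' c} → Cloud r c → Cloud r' c → r ≡ r'
  cloud-unique-row x y = go (clouds-distinct-columns D₀ W H []) x y
    where
    go : ∀ {xs r r' c} → AllPairs (λ p q → proj₂ p ≢ proj₂ q) xs →
      (r , c) ∈ xs → (r' , c) ∈ xs → r ≡ r'
    go (_ ∷ _) (here refl) (here refl) = refl
    go (a ∷ _) (here refl) (there y) = contradiction refl (lookup a y)
    go (a ∷ _) (there x) (here refl) = contradiction refl (lookup a x)
    go (_ ∷ as) (there x) (there y) = go as x y

  present-cloud : ∀ {r c} → Present r c →
    (∃ λ d → Cloud r d × c ≤ d) ⊎ (∃ λ k → Cloud k c × r < k)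
  present-cloud {r} {c} p
    with occupied-cloud D₀ W H [] (present⇒1≤row r c p) (present⇒row≤H r c p)
           (present⇒1≤col r c p) (present⇒col≤W r c p) (present⇒occupied r c p)
  ... | inj₁ x = inj₁ x
  ... | inj₂ (inj₁ y) = inj₂ y

  -- Right-justification makes the columns of the clouds seen so far a final segment of 1 … W.
  cloud-right : ∀ {r c c'} → Cloud r c → c < c' → c' ≤ W → ∃ λ k → Cloud k c' × r < k
  cloud-right {r} x c<c' c'≤W
    with present-cloud (present-upward r (cloud⇒present x) (<⇒≤ c<c') c'≤W)
  ... | inj₂ y = y
  ... | inj₁ (d , y , c'≤d) =
    contradiction (cloud-unique-col x y) (<⇒≢ (<-≤-trans c<c' c'≤d))

  -- If `c` were right of `d`, then `cloud-right` would put a cloud above row `k` in column `c`,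
  -- whose only cloud is in row `r`.
  lower-cloud-left : ∀ {r k c d} → r ≤ k → Cloud r c → Cloud k d → c ≤ d
  lower-cloud-left {r} {k} {c} {d} r≤k x y with c ≤? d
  ... | yes c≤d = c≤d
  ... | no c≰d with k' , z , k<k' ← cloud-right y (≰⇒> c≰d) (present⇒col≤W r c (cloud⇒present x))
                  with refl ← cloud-unique-row x z = contradiction r≤k (<⇒≱ k<k')

  rank-nonempty : ∀ r → Nonempty (suc r) → rank (suc r) ≡ suc (rank r)
  rank-nonempty r h rewrite h = refl

  rank-empty : ∀ r → nonempty (suc r) ≡ false → rank (suc r) ≡ rank r
  rank-empty r h rewrite h = refl

  rank-step : ∀ r → rank r ≤ rank (suc r)
  rank-step r with nonempty (suc r)
  ... | true = n≤1+n _
  ... | false = ≤-refl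

  rank-suc : ∀ r → rank (suc r) ≤ suc (rank r)
  rank-suc r with nonempty (suc r)
  ... | true = ≤-refl
  ... | false = n≤1+n _

  rank-mono : ∀ {r r'} → r ≤ r' → rank r ≤ rank r'
  rank-mono {zero} _ = z≤n
  rank-mono {suc r} {suc r'} l with m≤n⇒m<n∨m≡n l
  ... | inj₂ refl = ≤-refl
  ... | inj₁ l' = ≤-trans (rank-mono (s≤s⁻¹ l')) (rank-step r')

  rank≤ : ∀ r → rank r ≤ r
  rank≤ zero = z≤n
  rank≤ (suc r) = ≤-trans (rank-suc r) (s≤s (rank≤ r))

  -- The number of empty rows below a row is monotone, so rank r < r propagates upward.
  rank<-upward : ∀ {r r'} → rank r < r → r ≤ r' → rank r' < r'
  rank<-upward {r' = zero} h z≤n = h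
  rank<-upward {r} {suc r'} h l with m≤n⇒m<n∨m≡n l
  ... | inj₂ refl = h
  ... | inj₁ l' = ≤-<-trans (rank-suc r') (s≤s (rank<-upward h (s≤s⁻¹ l')))

  -- The labelling invariant and its preservation by a move.

  -- `pos ρ c` is the current row of the cell of column `c` labelled `ρ`, and `lab r c` the label of
  -- a ghost at `(r , c)`; other values are meaningless. By `gh-above` and `gh-below` a ghost
  -- separates its own cell from those of larger label, which cannot jump over it.
  record Labelled (D : Diagram) (pos lab : ℕ → ℕ → ℕ) : Set where
    field
      pos-ord   : ∀ {ρ c} → Present ρ c → D (pos ρ c) c ≡ ord
      ord-pos   : ∀ {r c} → D r c ≡ ord → ∃ λ ρ → Present ρ c × pos ρ c ≡ r
      pos-mono  : ∀ {ρ ρ' c} → Present ρ c → Present ρ' c → ρ < ρ' → pos ρ c < pos ρ' c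
      pos-right : ∀ {ρ c c'} → Present ρ c → c ≤ c' → c' ≤ W → pos ρ c' ≤ pos ρ c
      pos-low   : ∀ {ρ c} → Present ρ c → pos ρ c ≤ ρ
      pos≥1     : ∀ {ρ c} → Present ρ c → 1 ≤ pos ρ c
      gh-lab    : ∀ {r c} → D r c ≡ gh → Present (lab r c) c
      gh-above  : ∀ {r c} → D r c ≡ gh → pos (lab r c) c < r
      gh-low    : ∀ {r c} → D r c ≡ gh → r ≤ lab r c
      gh-below  : ∀ {r c ρ} → D r c ≡ gh → Present ρ c → lab r c < ρ → r < pos ρ c
      gh-row    : ∀ {r c c'} → D r c ≡ gh → D r c' ≡ gh → lab r c ≡ lab r c' → c ≡ c'

  labelled-start : Labelled D₀ (λ ρ _ → ρ) (λ r _ → r)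
  labelled-start = record
    { pos-ord = λ p → p
    ; ord-pos = λ p → _ , p , refl
    ; pos-mono = λ _ _ l → l
    ; pos-right = λ _ _ _ → ≤-refl
    ; pos-low = λ _ → ≤-refl
    ; pos≥1 = λ {ρ} {c} p → present⇒1≤row ρ c p
    ; gh-lab = λ {r} {c} e → ⊥-elim (no-ghost r c e)
    ; gh-above = λ {r} {c} e → ⊥-elim (no-ghost r c e)
    ; gh-low = λ _ → ≤-refl
    ; gh-below = λ _ _ l → l
    ; gh-row = λ {r} {c} e _ _ → ⊥-elim (no-ghost r c e)
    }

  module Step {D : Diagram} {pos lab : ℕ → ℕ → ℕ} (L : Labelled D pos lab)
              {s c ŝ : ℕ} {g : Cell} (tr : Trace g) (md : MoveData D s c ŝ) where

    open Labelled L

    right-empty : ∀ j → c < j → D s j ≡ emp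
    right-empty = proj₂ (proj₁ md)

    source-ord : D s c ≡ ord
    source-ord = proj₁ (proj₂ md)

    1≤ŝ : 1 ≤ ŝ
    1≤ŝ = proj₁ (proj₂ (proj₂ md))

    ŝ<s : ŝ < s
    ŝ<s = proj₁ (proj₂ (proj₂ (proj₂ md)))

    landing-emp : D ŝ c ≡ emp
    landing-emp = proj₁ (proj₂ (proj₂ (proj₂ (proj₂ md))))

    between-ord : ∀ r → ŝ < r → r ≤ s → D r c ≡ ord
    between-ord r l l' with m≤n⇒m<n∨m≡n l'
    ... | inj₁ l'' = proj₂ (proj₂ (proj₂ (proj₂ (proj₂ md)))) r l l''
    ... | inj₂ refl = source-ord

    D' : Diagram
    D' = move D s c ŝ g

    ρ₀ : ℕ
    ρ₀ = proj₁ (ord-pos source-ord)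

    ρ₀-present : Present ρ₀ c
    ρ₀-present = proj₁ (proj₂ (ord-pos source-ord))

    pos-ρ₀ : pos ρ₀ c ≡ s
    pos-ρ₀ = proj₂ (proj₂ (ord-pos source-ord))

    pos' : ℕ → ℕ → ℕ
    pos' ρ j with j ≟ c
    ... | yes _ = lower ŝ s (pos ρ j)
    ... | no _ = pos ρ j

    lab' : ℕ → ℕ → ℕ
    lab' i j with i ≟ s | j ≟ c
    ... | yes _ | yes _ = ρ₀
    ... | _ | _ = lab i j

    pos'-col : ∀ ρ → Lowered ŝ s (pos ρ c) (pos' ρ c)
    pos'-col ρ with c ≟ c
    ... | yes _ = lowered ŝ s (pos ρ c)
    ... | no ne = contradiction refl ne

    pos'≤ : ∀ ρ j → pos' ρ j ≤ pos ρ j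
    pos'≤ ρ j with j ≟ c
    ... | yes refl = lowered≤ (lowered ŝ s (pos ρ j))
    ... | no _ = ≤-refl

    data Site (i j : ℕ) : Set where
      landing : i ≡ ŝ → j ≡ c → D' i j ≡ ord → Site i j
      source  : i ≡ s → j ≡ c → D' i j ≡ g → Site i j
      away    : ¬ (i ≡ s × j ≡ c) → ¬ (i ≡ ŝ × j ≡ c) → D' i j ≡ D i j → Site i j

    site : ∀ i j → Site i j
    site i j with j ≟ c | i ≟ ŝ | i ≟ s
    ... | no j≢c | _ | _ =
      away (λ (_ , e) → j≢c e) (λ (_ , e) → j≢c e)
        (move-other D s c ŝ g (λ (_ , e) → j≢c e) (λ (_ , e) → j≢c e))
    ... | yes refl | yes refl | _ = landing refl refl (move-landing D s c ŝ g)
    ... | yes refl | no _ | yes refl = source refl refl (move-source D s c ŝ g ŝ<s)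
    ... | yes refl | no n | no n' =
      away (λ (e , _) → n' e) (λ (e , _) → n e)
        (move-other D s c ŝ g (λ (e , _) → n' e) (λ (e , _) → n e))

    pos'-ord : ∀ {ρ j} → Present ρ j → D' (pos' ρ j) j ≡ ord
    pos'-ord {ρ} {j} p with j ≟ c
    ... | no j≢c with site (pos ρ j) j
    ...   | landing _ e _ = contradiction e j≢c
    ...   | source _ e _ = contradiction e j≢c
    ...   | away _ _ e = trans e (pos-ord p)
    pos'-ord {ρ} {j} p | yes refl with lower ŝ s (pos ρ j) | lowered ŝ s (pos ρ j)
    ... | y | down l l' q with site y j
    ...   | landing _ _ e = e
    ...   | source refl _ _ = contradiction (subst (_≤ s) (sym q) l') 1+n≰n
    ...   | away n n' e = trans e
            (between-ord y (≤∧≢⇒< (s≤s⁻¹ (subst (ŝ <_) (sym q) l)) (λ z → n' (sym z , refl)))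
              (<⇒≤ (subst (_≤ s) (sym q) l')))
    pos'-ord {ρ} {j} p | yes refl | _ | stay ns with site (pos ρ j) j
    ...   | landing _ _ e = e
    ...   | source q _ _ = contradiction (subst (ŝ <_) (sym q) ŝ<s , ≤-reflexive q) ns
    ...   | away _ _ e = trans e (pos-ord p)

    ord-pos' : ∀ {r j} → D' r j ≡ ord → ∃ λ ρ → Present ρ j × pos' ρ j ≡ r
    ord-pos' {r} {j} h with j ≟ c
    ord-pos' {r} {j} h | no j≢c with site r j
    ... | landing _ e _ = contradiction e j≢c
    ... | source _ e _ = contradiction e j≢c
    ... | away _ _ e = ord-pos (trans (sym e) h)
    ord-pos' {r} {j} h | yes refl = go (site r j)
      where
      found : ∀ {ρ y} → pos ρ j ≡ y → (ŝ < y → y ≤ s → y ≡ suc r) →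
              (¬ (ŝ < y × y ≤ s) → y ≡ r) → lower ŝ s (pos ρ j) ≡ r
      found {ρ} refl f f' with lower ŝ s (pos ρ j) | lowered ŝ s (pos ρ j)
      ... | y | down l l' e = suc-injective (trans e (f l l'))
      ... | _ | stay ns = f' ns
      -- Inside the lowered stretch, the cell now in row `r` came from row `suc r`; this includes
      -- the landing row `ŝ`.
      from-above : ŝ < suc r → suc r ≤ s → ∃ λ ρ → Present ρ j × lower ŝ s (pos ρ j) ≡ r
      from-above l l' with ρ , p , e ← ord-pos (between-ord (suc r) l l') =
        ρ , p , found e (λ _ _ → refl) (λ ns → contradiction (l , l') ns)
      go : Site r j → ∃ λ ρ → Present ρ j × lower ŝ s (pos ρ j) ≡ r
      go (landing refl _ _) = from-above ≤-refl ŝ<s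
      go (source refl refl e) = contradiction (trans (sym e) h) (trace≢ord tr)
      go (away n n' e) with ŝ <? r | r ≤? s
      ... | yes l | yes l' = from-above (m≤n⇒m≤1+n l) (≤∧≢⇒< l' (λ z → n (z , refl)))
      ... | yes l | no nl with ρ , p , q ← ord-pos (trans (sym e) h) =
        ρ , p , found q (λ _ l' → contradiction l' nl) (λ _ → refl)
      ... | no nl | _ with ρ , p , q ← ord-pos (trans (sym e) h) =
        ρ , p , found q (λ l _ → contradiction l nl) (λ _ → refl)

    pos≢ŝ : ∀ {ρ} → Present ρ c → pos ρ c ≢ ŝ
    pos≢ŝ p e = emp≢ord landing-emp (trans (cong (λ z → D z c) (sym e)) (pos-ord p))

    pos'-mono : ∀ {ρ ρ' j} → Present ρ j → Present ρ' j → ρ < ρ' → pos' ρ j < pos' ρ' j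
    pos'-mono {ρ} {ρ'} {j} p p' l with j ≟ c
    ... | no _ = pos-mono p p' l
    ... | yes refl with lower ŝ s (pos ρ j) | lowered ŝ s (pos ρ j)
                      | lower ŝ s (pos ρ' j) | lowered ŝ s (pos ρ' j) | pos-mono p p' l
    ...   | y | dn | _ | stay _ | q = ≤-<-trans (lowered≤ dn) q
    ...   | y | down a b e | y' | down a' b' e' | q = s≤s⁻¹ (subst (suc (suc y) ≤_) (sym e') (subst (_< pos ρ' j) (sym e) q))
    -- The unmoved label is at or below `ŝ`, and not at `ŝ`, which was empty; the lowered one stops
    -- at `ŝ` or higher.
    ...   | _ | stay ns | y' | down a' b' e' | q =
      <-≤-trans (≤∧≢⇒< (≮⇒≥ λ l → ns (l , ≤-trans (<⇒≤ q) b')) (pos≢ŝ p))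
                (s≤s⁻¹ (subst (ŝ <_) (sym e') a'))

    -- Induction down the chain from row s: every column further right is empty in row s, so the
    -- top label is strictly lower there, and each next label is lower still.
    strict-right : ∀ {j} → c < j → j ≤ W → ∀ n {ρ} → Present ρ c → ŝ < pos ρ c →
      pos ρ c + n ≡ s → pos ρ j < pos ρ c
    strict-right {j} c<j j≤W zero {ρ} p l e =
      ≤∧≢⇒< (pos-right p (<⇒≤ c<j) j≤W) λ q →
        emp≢ord (right-empty j c<j)
          (trans (cong (λ z → D z j) (sym (trans q (trans (sym (+-identityʳ _)) e))))
            (pos-ord (present-upward ρ p (<⇒≤ c<j) j≤W)))
    strict-right {j} c<j j≤W (suc n) {ρ} p l e
      with ρ⁺ , p⁺ , e⁺ ← ord-pos (between-ord (suc (pos ρ c)) (m≤n⇒m≤1+n l)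
             (subst (suc (pos ρ c) ≤_) (trans (sym (+-suc _ n)) e) (s≤s (m≤m+n _ n)))) =
      <-≤-trans (pos-mono (pr ρ p) (pr ρ⁺ p⁺) ρ<ρ⁺) (s≤s⁻¹ (subst (pos ρ⁺ j <_) e⁺
        (strict-right c<j j≤W n p⁺ (subst (ŝ <_) (sym e⁺) (m≤n⇒m≤1+n l))
          (trans (cong (_+ n) e⁺) (trans (sym (+-suc _ n)) e)))))
      where
      pr : ∀ x → Present x c → Present x j
      pr x q = present-upward x q (<⇒≤ c<j) j≤W
      ρ<ρ⁺ : ρ < ρ⁺
      ρ<ρ⁺ with <-cmp ρ ρ⁺
      ... | tri< x _ _ = x
      ... | tri≈ _ refl _ = contradiction (sym e⁺) 1+n≢n
      ... | tri> _ _ x = contradiction (subst (_< pos ρ c) e⁺ (pos-mono p⁺ p x)) (<⇒≯ ≤-refl)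

    -- Lowering a column further right only helps. Lowering column `j` itself costs one row, which
    -- the strictness from `strict-right` pays for.
    pos'-right : ∀ {ρ j j'} → Present ρ j → j ≤ j' → j' ≤ W → pos' ρ j' ≤ pos' ρ j
    pos'-right {ρ} {j} {j'} p l l' with m≤n⇒m<n∨m≡n l
    ... | inj₂ refl = ≤-refl
    ... | inj₁ j<j' with j ≟ c
    ...   | no _ = ≤-trans (pos'≤ ρ j') (pos-right p l l')
    ...   | yes refl with lower ŝ s (pos ρ j) | lowered ŝ s (pos ρ j)
    ...     | _ | stay _ = ≤-trans (pos'≤ ρ j') (pos-right p l l')
    ...     | y | down a b e = ≤-trans (pos'≤ ρ j')
                (s≤s⁻¹ (subst (pos ρ j' <_) (sym e) (strict-right j<j' l' (s ∸ pos ρ j) p a (m+[n∸m]≡n b))))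

    pos'≥1 : ∀ {ρ j} → Present ρ j → 1 ≤ pos' ρ j
    pos'≥1 {ρ} {j} p with j ≟ c
    ... | no _ = pos≥1 p
    ... | yes refl with lower ŝ s (pos ρ j) | lowered ŝ s (pos ρ j)
    ...   | _ | stay _ = pos≥1 p
    ...   | y | down a b e = ≤-trans 1≤ŝ (s≤s⁻¹ (subst (ŝ <_) (sym e) a))

    data GhostSite (i j : ℕ) : Set where
      fresh : i ≡ s → j ≡ c → lab' i j ≡ ρ₀ → GhostSite i j
      old   : D i j ≡ gh → lab' i j ≡ lab i j → GhostSite i j

    ghost-site : ∀ {i j} → D' i j ≡ gh → GhostSite i j
    ghost-site {i} {j} h with site i j
    ... | landing _ _ e = contradiction h (ord≢gh e)
    ... | source refl refl e = fresh refl refl lem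
      where
      lem : lab' s c ≡ ρ₀
      lem with s ≟ s | c ≟ c
      ... | yes _ | yes _ = refl
      ... | no n | _ = contradiction refl n
      ... | yes _ | no n = contradiction refl n
    ... | away n n' e = old (trans (sym e) h) lem
      where
      lem : lab' i j ≡ lab i j
      lem with i ≟ s | j ≟ c
      ... | yes a | yes b = contradiction (a , b) n
      ... | yes _ | no _ = refl
      ... | no _ | _ = refl

    gh'-lab : ∀ {i j} → D' i j ≡ gh → Present (lab' i j) j
    gh'-lab {i} {j} h with ghost-site {i} {j} h
    ... | fresh refl refl q rewrite q = ρ₀-present
    ... | old e q rewrite q = gh-lab e

    gh'-above : ∀ {i j} → D' i j ≡ gh → pos' (lab' i j) j < i
    gh'-above {i} {j} h with ghost-site {i} {j} h
    ... | old e q rewrite q = ≤-<-trans (pos'≤ _ j) (gh-above e)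
    ... | fresh refl refl q rewrite q with pos' ρ₀ c | pos'-col ρ₀
    ...   | y | down a b e = subst (y <_) pos-ρ₀ (≤-reflexive e)
    ...   | _ | stay ns = contradiction (subst (ŝ <_) (sym pos-ρ₀) ŝ<s , ≤-reflexive pos-ρ₀) ns

    gh'-low : ∀ {i j} → D' i j ≡ gh → i ≤ lab' i j
    gh'-low {i} {j} h with ghost-site {i} {j} h
    ... | old e q rewrite q = gh-low e
    ... | fresh refl refl q rewrite q = subst (_≤ ρ₀) pos-ρ₀ (pos-low ρ₀-present)

    -- A lowered cell enters either `ŝ`, which was empty, or a row of the stretch that held an
    -- ordinary cell; so it never comes down onto an old ghost.
    old-below : ∀ {i j ρ} → D i j ≡ gh → Present ρ j → lab i j < ρ → i < pos' ρ j
    old-below {i} {j} {ρ} e p l with j ≟ c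
    ... | no _ = gh-below e p l
    ... | yes refl with lower ŝ s (pos ρ j) | lowered ŝ s (pos ρ j)
    ...   | _ | stay _ = gh-below e p l
    ...   | y | down a b q = ≤∧≢⇒< (s≤s⁻¹ (subst (i <_) (sym q) (gh-below e p l))) i≢y
      where
      i≢y : i ≢ y
      i≢y refl with m≤n⇒m<n∨m≡n (s≤s⁻¹ (subst (ŝ <_) (sym q) a))
      ... | inj₁ ŝ<y = contradiction e (ord≢gh (between-ord y ŝ<y (<⇒≤ (subst (_≤ s) (sym q) b))))
      ... | inj₂ refl = contradiction e (emp≢gh landing-emp)

    gh'-below : ∀ {i j ρ} → D' i j ≡ gh → Present ρ j → lab' i j < ρ → i < pos' ρ j
    gh'-below {i} {j} {ρ} h p l with ghost-site {i} {j} h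
    ... | old e q = old-below e p (subst (_< ρ) q l)
    ... | fresh refl refl q
      -- Labels larger than that of the new ghost are above row `s`, hence outside the lowered
      -- stretch.
      with pos' ρ c | pos'-col ρ | pos-mono ρ₀-present p (subst (_< ρ) q l)
    ...   | _ | stay _ | r = subst (_< pos ρ c) pos-ρ₀ r
    ...   | _ | down a b e | r = contradiction (subst (_< pos ρ c) pos-ρ₀ r) (≤⇒≯ b)

    -- A new ghost (s , c) cannot share its label with an old ghost (s , j): row s is empty to the
    -- right of c, and for j < c the label is already below row s in every column right of j.
    fresh-label : ∀ {j} → D s j ≡ gh → ρ₀ ≢ lab s j
    fresh-label {j} e q with <-cmp c j
    ... | tri< l _ _ = contradiction e (emp≢gh (right-empty j l))
    ... | tri≈ _ refl _ = contradiction e (ord≢gh source-ord)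
    ... | tri> _ _ l = contradiction
      (≤-<-trans
        (pos-right (subst (λ x → Present x j) (sym q) (gh-lab e)) (<⇒≤ l)
          (present⇒col≤W ρ₀ c ρ₀-present))
        (subst (λ x → pos x j < s) (sym q) (gh-above e)))
      (≤⇒≯ (≤-reflexive (sym pos-ρ₀)))

    gh'-row : ∀ {i j j'} → D' i j ≡ gh → D' i j' ≡ gh → lab' i j ≡ lab' i j' → j ≡ j'
    gh'-row {i} {j} {j'} h h' q with ghost-site {i} {j} h | ghost-site {i} {j'} h'
    ... | fresh _ e _ | fresh _ e' _ = trans e (sym e')
    ... | fresh refl refl e | old x e' = contradiction (trans (sym e) (trans q e')) (fresh-label x)
    ... | old x e' | fresh refl refl e = contradiction (trans (sym e) (trans (sym q) e')) (fresh-label x)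
    ... | old x e | old x' e' = gh-row x x' (trans (sym e) (trans q e'))

    labelled-step : Labelled D' pos' lab'
    labelled-step = record
      { pos-ord = λ {ρ} {j} → pos'-ord {ρ} {j}
      ; ord-pos = λ {r} {j} → ord-pos' {r} {j}
      ; pos-mono = λ {ρ} {ρ'} {j} → pos'-mono {ρ} {ρ'} {j}
      ; pos-right = λ {ρ} {j} {j'} → pos'-right {ρ} {j} {j'}
      ; pos-low = λ {ρ} {j} p → ≤-trans (pos'≤ ρ j) (pos-low p)
      ; pos≥1 = λ {ρ} {j} → pos'≥1 {ρ} {j}
      ; gh-lab = λ {i} {j} → gh'-lab {i} {j}
      ; gh-above = λ {i} {j} → gh'-above {i} {j}
      ; gh-low = λ {i} {j} → gh'-low {i} {j}
      ; gh-below = λ {i} {j} {ρ} → gh'-below {i} {j} {ρ}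
      ; gh-row = λ {i} {j} {j'} → gh'-row {i} {j} {j'}
      }

  labelled-reachable : ∀ {D D' pos lab} → Labelled D pos lab → InKKD D D' →
    ∃ λ pos' → ∃ λ lab' → Labelled D' pos' lab'
  labelled-reachable L ε = _ , _ , L
  labelled-reachable L (kohnert r c r̂ md ◅ st) = labelled-reachable (Step.labelled-step L vacated md) st
  labelled-reachable L (ghost r c r̂ md ◅ st) = labelled-reachable (Step.labelled-step L haunted md) st

  -- Upper bound: charging ghosts to slots.

  -- Rows `rank k + 1` to `k` below and at the cloud of row `k`: as many as the snowflakes left
  -- under that cloud, though in general at other positions. They are the ghost positions of the
  -- extremal diagram.
  slots : ℕ × ℕ → List (ℕ × ℕ)
  slots (k , c) = map (λ i → suc (rank k + i) , c) (upTo (k ∸ rank k))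

  targets : List (ℕ × ℕ)
  targets = concat (map slots (darkClouds H W D₀))

  ∈-slots⁺ : ∀ {k c m} → rank k < m → m ≤ k → (m , c) ∈ slots (k , c)
  ∈-slots⁺ {k} {c} {suc m} (s≤s l) l' = subst (λ z → (suc z , c) ∈ slots (k , c)) (m+[n∸m]≡n l)
    (∈-map⁺ _ (∈-upTo⁺ (∸-monoˡ-< l' l)))

  ∈-slots⁻ : ∀ {k c m d} → (m , d) ∈ slots (k , c) → rank k < m × m ≤ k × d ≡ c
  ∈-slots⁻ {k} x with i , i∈ , refl ← ∈-map⁻ _ x =
    s≤s (m≤m+n (rank k) i) ,
    subst (suc (rank k + i) ≤_) (m+[n∸m]≡n (rank≤ k))
      (subst (_≤ rank k + (k ∸ rank k)) (+-suc (rank k) i) (+-monoʳ-≤ (rank k) (∈-upTo⁻ i∈))) ,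
    refl

  ∈-targets⁺ : ∀ {k c m} → Cloud k c → rank k < m → m ≤ k → (m , c) ∈ targets
  ∈-targets⁺ x l l' = ∈-concat⁺′ (∈-slots⁺ l l') (∈-map⁺ slots x)

  ∈-targets⁻ : ∀ {m c} → (m , c) ∈ targets → ∃ λ k → Cloud k c × rank k < m × m ≤ k
  ∈-targets⁻ x with _ , y , z ← ∈-concat⁻′ _ x with (k , c) , w , refl ← ∈-map⁻ slots z
               with l , l' , refl ← ∈-slots⁻ y = k , w , l , l'

  -- `B` will be the bad row, or a row above the diagram if there is none. Below `B` a cloud is
  -- asked for only where `rank ρ < ρ`, since other labels leave no ghost.
  module Bound {D : Diagram} {pos lab : ℕ → ℕ → ℕ} (L : Labelled D pos lab) (B : ℕ)
    (clouds-below : ∀ ρ → Nonempty ρ → rank ρ < ρ → ρ < B → ∃ λ c → Cloud ρ c)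
    (clouds-above : ∀ ρ → Nonempty ρ → B < ρ → ∃ λ c → Cloud ρ c) where

    open Labelled L

    -- Labels of one column occupy distinct rows in increasing order, so each nonempty row in
    -- `ρ < x ≤ m` pushes the later labels up by one more row above `t`. Their number is `rank m`
    -- minus `rank ρ`, written additively.
    climb : ∀ {c ρ t} → (∀ x → Present x c → ρ < x → t < pos x c) →
      ∀ m → ρ ≤ m → (∀ x → Nonempty x → ρ < x → x ≤ m → Present x c) →
      ∀ x → Present x c → m < x → t + rank m < pos x c + rank ρ
    climb {c} {ρ} {t} base m ρ≤m cont x p l with m≤n⇒m<n∨m≡n ρ≤m
    ... | inj₂ refl = +-monoˡ-< (rank ρ) (base x p l)
    climb {c} {ρ} {t} base (suc m) ρ≤m cont x p l | inj₁ ρ<m with nonempty (suc m) in eq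
    ... | false = climb base m (s≤s⁻¹ ρ<m) (λ y n a b → cont y n a (m≤n⇒m≤1+n b)) x p (<⇒≤ l)
    ... | true with pm ← cont (suc m) eq ρ<m ≤-refl =
      subst (_< pos x c + rank ρ) (sym (+-suc t (rank m)))
        (≤-<-trans
          (climb base m (s≤s⁻¹ ρ<m) (λ y n a b → cont y n a (m≤n⇒m≤1+n b)) (suc m) pm ≤-refl)
          (+-monoˡ-< (rank ρ) (pos-mono pm p l)))

    -- `climb` stopped just below `k`; counting row `k` itself turns the strict bound into a weak
    -- one.
    gap : ∀ {c ρ t} → (∀ x → Present x c → ρ < x → t < pos x c) →
      ∀ k → ρ < k → (∀ x → Nonempty x → ρ < x → x < k → Present x c) → Present k c →
      t + rank k ≤ pos k c + rank ρ
    gap {c} {ρ} {t} base (suc k) l cont p =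
      subst (λ z → t + z ≤ pos (suc k) c + rank ρ)
        (sym (rank-nonempty k (present⇒nonempty (suc k) c p)))
        (subst (_≤ pos (suc k) c + rank ρ) (sym (+-suc t (rank k)))
          (climb base k (s≤s⁻¹ l) (λ x n a b → cont x n a (s≤s b)) (suc k) p ≤-refl))

    -- Column `W` meets every nonempty row, so `gap` applies there from row 0; further left the
    -- label is at least as high.
    rank≤pos : ∀ {ρ c} → Present ρ c → rank ρ ≤ pos ρ c
    rank≤pos {ρ} {c} p = ≤-trans
      (subst (rank ρ ≤_) (+-identityʳ _)
        (gap {W} {0} {0} (λ x q _ → pos≥1 q) ρ (present⇒1≤row ρ c p) (λ x n _ _ → nonempty⇒present x n) pW))
      (pos-right p (present⇒col≤W ρ c p) ≤-refl)
      where pW = present-upward ρ p (present⇒col≤W ρ c p) ≤-refl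

    -- Row `x` has a cloud, which lies weakly left of that of row `k`; right-justification fills the
    -- rest.
    present-below-cloud : ∀ {k c x} → Cloud k c → Nonempty x → B < x → x ≤ k → Present x c
    present-below-cloud {k} {c} {x} cl n l l' with d , cl' ← clouds-above x n l =
      present-upward x (cloud⇒present cl') (lower-cloud-left l' cl' cl) (present⇒col≤W k c (cloud⇒present cl))

    -- A ghost is charged to a slot of its own label, or, if its column holds the cloud of a later
    -- row k, it is shifted up past the cells labelled up to k to a slot of row k.
    data Charge : ℕ × ℕ → ℕ × ℕ → Set where
      own     : ∀ {r c d} → D r c ≡ gh → Cloud (lab r c) d → lab r c < B ⊎ c ≤ d →
                Charge (r , c) (r , d)
      shifted : ∀ {r c k m} → D r c ≡ gh → B ≤ lab r c → lab r c < k → Cloud k c →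
                m + rank (lab r c) ≡ r + rank k → Charge (r , c) (m , c)

    -- Every nonempty row after the ghost's label and up to `k` has a cell in this column, and by
    -- `gh-below` all these are above row `r`. The shift from `r` to `m` is exactly their number.
    shifted≤ : ∀ {r c k m} → D r c ≡ gh → B ≤ lab r c → lab r c < k → Cloud k c →
      m + rank (lab r c) ≡ r + rank k → m ≤ pos k c
    shifted≤ {r} {c} {k} {m} g b l cl e = +-cancelʳ-≤ (rank (lab r c)) m (pos k c)
      (subst (_≤ pos k c + rank (lab r c)) (sym e)
        (gap (λ x p l' → gh-below g p l') k l
          (λ x n a a' → present-below-cloud cl n (≤-<-trans b a) (<⇒≤ a')) (cloud⇒present cl)))

    -- The cell of the larger label is pushed above `r` by all labels in between, and its ghost in
    -- row `r'` is higher still.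
    shifted-mono : ∀ {r r' c k} → D r c ≡ gh → D r' c ≡ gh → B ≤ lab r c → lab r' c < k → Cloud k c →
      lab r c < lab r' c → r + rank (lab r' c) < r' + rank (lab r c)
    shifted-mono {r} {r'} {c} {k} g g' b l cl q = ≤-<-trans
      (gap (λ x p l' → gh-below g p l') (lab r' c) q
        (λ x n a a' → present-below-cloud cl n (≤-<-trans b a) (<⇒≤ (<-trans a' l))) (gh-lab g'))
      (+-monoˡ-< (rank (lab r c)) (gh-above g'))

    -- In the slots of row `k`, shifted charges end at or below `pos k d`, whereas an own charge
    -- with `c ≤ d` is above `pos k c`, hence above `pos k d`. If `k < B`, no shifted charge reaches
    -- row `k`.
    own-shifted : ∀ {r c d r' k m} → D r c ≡ gh → Cloud (lab r c) d → lab r c < B ⊎ c ≤ d →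
      D r' d ≡ gh → B ≤ lab r' d → lab r' d < k → Cloud k d → m + rank (lab r' d) ≡ r' + rank k →
      r ≢ m
    own-shifted {r} {c} {d} g cl h g' b l cl' e refl with refl ← cloud-unique-row cl cl' with h
    ... | inj₁ h' = contradiction (<-trans h' (≤-<-trans b l)) 1+n≰n
    ... | inj₂ c≤d = contradiction (gh-above g)
      (≤⇒≯ (≤-trans (shifted≤ g' b l cl' e)
        (pos-right (gh-lab g) c≤d (present⇒col≤W (lab r c) d (cloud⇒present cl)))))

    charge-injective : ∀ {x x' y} → Charge x y → Charge x' y → x ≡ x'
    charge-injective (own {r} g cl _) (own g' cl' _) = cong (r ,_) (gh-row g g' (cloud-unique-row cl cl'))
    charge-injective (own g cl h) (shifted g' b l cl' e) = contradiction refl (own-shifted g cl h g' b l cl' e)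
    charge-injective (shifted g' b l cl' e) (own g cl h) = contradiction refl (own-shifted g cl h g' b l cl' e)
    charge-injective (shifted {r} {c} {k} {m} g b l cl e) (shifted {r'} g' b' l' cl' e')
      with refl ← cloud-unique-row cl cl' with <-cmp (lab r c) (lab r' c)
    ... | tri< q _ _ = contradiction (exchange m e e') (<⇒≢ (shifted-mono g g' b l' cl q))
    ... | tri≈ _ q _ = cong (_, c) (+-cancelʳ-≡ (rank k) r r'
                         (trans (sym e) (trans (cong (λ z → m + rank z) q) e')))
    ... | tri> _ _ q = contradiction (exchange m e' e) (<⇒≢ (shifted-mono g' g b' l cl q))

    charge : ∀ {r c} → D r c ≡ gh → ∃ λ y → y ∈ targets × Charge (r , c) y
    charge {r} {c} g with lab r c <? B
    ... | yes l with d , cl ← clouds-below (lab r c) (present⇒nonempty (lab r c) c (gh-lab g))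
                       (≤-<-trans (rank≤pos (gh-lab g)) (<-≤-trans (gh-above g) (gh-low g))) l =
      (r , d) , ∈-targets⁺ cl (≤-<-trans (rank≤pos (gh-lab g)) (gh-above g)) (gh-low g) ,
      own g cl (inj₁ l)
    -- Either the label's own cloud is weakly right of the ghost, or the ghost's column belongs to
    -- the cloud of a later row.
    ... | no nl with present-cloud (gh-lab g)
    ...   | inj₁ (d , cl , c≤d) =
      (r , d) , ∈-targets⁺ cl (≤-<-trans (rank≤pos (gh-lab g)) (gh-above g)) (gh-low g) ,
      own g cl (inj₂ c≤d)
    ...   | inj₂ (k , cl , l) =
      (m , c) , ∈-targets⁺ cl rank<m
        (≤-trans (shifted≤ g (≮⇒≥ nl) l cl e) (pos-low (cloud⇒present cl))) ,
      shifted g (≮⇒≥ nl) l cl e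
      where
      ρ m : ℕ
      ρ = lab r c
      m = r + (rank k ∸ rank ρ)
      e : m + rank ρ ≡ r + rank k
      e = trans (+-assoc r _ _) (cong (r +_) (m∸n+n≡m (rank-mono (<⇒≤ l))))
      -- The inequality `rank ρ < r`, shifted by `rank k` minus `rank ρ`.
      rank<m : rank k < m
      rank<m = +-cancelʳ-< (rank ρ) (rank k) m (subst (rank k + rank ρ <_) (sym e)
        (subst (_< r + rank k) (+-comm (rank ρ) (rank k))
          (+-monoˡ-< (rank k) (≤-<-trans (rank≤pos (gh-lab g)) (gh-above g)))))

    ghosts≤targets : ∀ k → GhostCount D k → k ≤ length targets
    ghosts≤targets k (ps , u , spec , refl) = length-injection Charge charge-injective targets u
      λ {(r , c)} x → charge (proj₁ (spec r c) x)

  -- Lower bound: a reachable diagram with a ghost in every slot.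

  cloud-col≥1 : ∀ {r c} → Cloud r c → 1 ≤ c
  cloud-col≥1 {r} {c} x = present⇒1≤col r c (cloud⇒present x)

  cloud-col≤W : ∀ {r c} → Cloud r c → c ≤ W
  cloud-col≤W {r} {c} x = present⇒col≤W r c (cloud⇒present x)

  -- Columns whose cloud is above row `ρ`, so that the rows up to `ρ` leave no ghosts in them.
  -- Columns beyond `W` are included to make the condition pass to everything further right.
  Free : ℕ → ℕ → Set
  Free ρ c = W < c ⊎ (∃ λ k → Cloud k c × ρ < k)

  free? : ∀ ρ c → Dec (Free ρ c)
  free? ρ c = (W <? c) ⊎-dec map′ from to
    (any? (λ p → (proj₂ p ≟ c) ×-dec (ρ <? proj₁ p)) (darkClouds H W D₀))
    where
    from : Any (λ p → proj₂ p ≡ c × ρ < proj₁ p) (darkClouds H W D₀) → ∃ λ k → Cloud k c × ρ < k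
    from a with _ , x , refl , l ← find a = _ , x , l
    to : (∃ λ k → Cloud k c × ρ < k) → Any (λ p → proj₂ p ≡ c × ρ < proj₁ p) (darkClouds H W D₀)
    to (_ , x , l) = lose x (refl , l)

  cloud? : ∀ r c → Dec (Cloud r c)
  cloud? r c = (r , c) ∈? darkClouds H W D₀

  free-upward : ∀ {ρ c c'} → Free ρ c → c < c' → Free ρ c'
  free-upward (inj₁ l) l' = inj₁ (<-trans l l')
  free-upward {c' = c'} (inj₂ (k , x , l)) l' with W <? c'
  ... | yes l'' = inj₁ l''
  ... | no nl with k' , x' , k<k' ← cloud-right x l' (≮⇒≥ nl) = inj₂ (k' , x' , <-trans l k<k')

  free-suc : ∀ {ρ c} → Free (suc ρ) c → Free ρ c
  free-suc (inj₁ l) = inj₁ l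
  free-suc (inj₂ (k , x , l)) = inj₂ (k , x , <⇒≤ l)

  free-earlier : ∀ {ρ c k} → Free ρ c → Cloud k c → ρ < k
  free-earlier (inj₁ l) x = contradiction (cloud-col≤W x) (<⇒≱ l)
  free-earlier (inj₂ (k , x' , l)) x with refl ← cloud-unique-row x x' = l

  -- The only obstacle is a cloud of row `suc ρ` strictly right of `c`. But column `c` is beyond `W`
  -- or has its cloud in row `suc ρ` or higher, and `lower-cloud-left` excludes this.
  free-right : ∀ {ρ c c'} → Free ρ c → c < c' → Free (suc ρ) c'
  free-right {ρ} {c} {c'} f l with free-upward f l
  ... | inj₁ l' = inj₁ l'
  ... | inj₂ (k , x , ρ<k) with m≤n⇒m<n∨m≡n ρ<k
  ...   | inj₁ l' = inj₂ (k , x , l')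
  ...   | inj₂ refl with f
  ...     | inj₁ l' = contradiction (cloud-col≤W x) (<⇒≱ (<-trans l' l))
  ...     | inj₂ (k' , x' , ρ<k') = contradiction l (≤⇒≯ (lower-cloud-left ρ<k' x x'))

  data Mark (r c : ℕ) : Cell → Set where
    marked   : Cloud r c → Mark r c gh
    unmarked : ¬ Cloud r c → Mark r c emp

  mark : ∀ r c → ∃ (Mark r c)
  mark r c with cloud? r c
  ... | yes x = gh , marked x
  ... | no nx = emp , unmarked nx

  mark-trace : ∀ {r c g} → Mark r c g → Trace g
  mark-trace (marked _) = haunted
  mark-trace (unmarked _) = vacated

  Haunted : ℕ → ℕ → ℕ → Set
  Haunted ρ i j = ∃ λ k → Cloud k j × k ≤ ρ × rank k < i × i ≤ k

  -- The state after rows `1` to `ρ`. Ordinary cells there are not tracked: they have gathered in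
  -- rows up to `rank ρ` or stand in columns no longer free.
  record Done (ρ : ℕ) (D : Diagram) : Set where
    field
      above : ∀ i j → ρ < i → D i j ≡ D₀ i j
      clear : ∀ i j → rank ρ < i → i ≤ ρ → Free ρ j → D i j ≡ emp
      ghost⁺ : ∀ i j → Haunted ρ i j → D i j ≡ gh
      ghost⁻ : ∀ i j → D i j ≡ gh → Haunted ρ i j

  HauntedRow : ℕ → ℕ → ℕ → ℕ → Set
  HauntedRow ρ c i j =
    Haunted ρ i j ⊎ (c < j × Cloud (suc ρ) j × rank (suc ρ) < i × i ≤ suc ρ)

  -- Row suc ρ is being emptied from right to left; the columns right of c are finished.
  record InRow (ρ c : ℕ) (D : Diagram) : Set where
    field
      above : ∀ i j → suc ρ < i → D i j ≡ D₀ i j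
      left : ∀ j → j ≤ c → D (suc ρ) j ≡ D₀ (suc ρ) j
      clear-left : ∀ i j → rank (suc ρ) ≤ i → i ≤ ρ → j ≤ c → Free ρ j → D i j ≡ emp
      clear-right : ∀ i j → rank (suc ρ) < i → i ≤ suc ρ → c < j → Free (suc ρ) j → D i j ≡ emp
      ghost⁺ : ∀ i j → HauntedRow ρ c i j → D i j ≡ gh
      ghost⁻ : ∀ i j → D i j ≡ gh → HauntedRow ρ c i j

  row-start : ∀ {ρ D} → Nonempty (suc ρ) → Done ρ D → InRow ρ W D
  row-start {ρ} {D} n d = record
    { above = λ i j l → above i j (<⇒≤ l)
    ; left = λ j _ → above (suc ρ) j ≤-refl
    -- As row `suc ρ` is nonempty, `rank (suc ρ) ≤ i` amounts to `rank ρ < i`; so the landing row of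
    -- its cells is clear too.
    ; clear-left = λ i j l l' _ f → clear i j (subst (_≤ i) (rank-nonempty ρ n) l) l' f
    ; clear-right = right
    ; ghost⁺ = λ { i j (inj₁ h) → ghost⁺ i j h
                 ; i j (inj₂ (l , x , _)) → contradiction (cloud-col≤W x) (<⇒≱ l) }
    ; ghost⁻ = λ i j e → inj₁ (ghost⁻ i j e)
    }
    where
    open Done d
    right : ∀ i j → rank (suc ρ) < i → i ≤ suc ρ → W < j → Free (suc ρ) j → D i j ≡ emp
    right i j l l' W<j _ with m≤n⇒m<n∨m≡n l'
    ... | inj₁ l'' = clear i j (≤-<-trans (rank-step ρ) l) (s≤s⁻¹ l'') (inj₁ W<j)
    ... | inj₂ refl = trans (above i j ≤-refl)
      (absent⇒emp i j (λ p → contradiction (present⇒col≤W i j p) (<⇒≱ W<j)))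

  row-skip : ∀ {ρ c D} → InRow ρ (suc c) D → ¬ Cloud (suc ρ) (suc c) →
    (∀ i → rank (suc ρ) < i → i ≤ suc ρ → Free (suc ρ) (suc c) → D i (suc c) ≡ emp) → InRow ρ c D
  row-skip {ρ} {c} {D} d nx cl = record
    { above = above
    ; left = λ j l → left j (m≤n⇒m≤1+n l)
    ; clear-left = λ i j l l' l'' → clear-left i j l l' (m≤n⇒m≤1+n l'')
    ; clear-right = right
    ; ghost⁺ = g⁺
    ; ghost⁻ = λ i j e → weaken (ghost⁻ i j e)
    }
    where
    open InRow d
    right : ∀ i j → rank (suc ρ) < i → i ≤ suc ρ → c < j → Free (suc ρ) j → D i j ≡ emp
    right i j l l' c<j f with m≤n⇒m<n∨m≡n c<j
    ... | inj₁ l'' = clear-right i j l l' l'' f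
    ... | inj₂ refl = cl i l l' f
    weaken : ∀ {i j} → HauntedRow ρ (suc c) i j → HauntedRow ρ c i j
    weaken (inj₁ h) = inj₁ h
    weaken (inj₂ (l , h)) = inj₂ (<⇒≤ l , h)
    g⁺ : ∀ i j → HauntedRow ρ c i j → D i j ≡ gh
    g⁺ i j (inj₁ h) = ghost⁺ i j (inj₁ h)
    g⁺ i j (inj₂ (c<j , x , h)) with m≤n⇒m<n∨m≡n c<j
    ... | inj₁ l = ghost⁺ i j (inj₂ (l , x , h))
    ... | inj₂ refl = contradiction x nx

  -- The cell walks down to row `rank (suc ρ)`. By `free-right` the columns to its right are free
  -- and already cleared, so it is rightmost all the way; the trail of a cloud is exactly its set of
  -- slots.
  row-walk : ∀ {ρ c D} → Nonempty (suc ρ) → InRow ρ (suc c) D →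
    Free ρ (suc c) → Present (suc ρ) (suc c) → ∃ λ D' → InKKD D D' × InRow ρ c D'
  row-walk {ρ} {c} {D} n d f p
    with g , mk ← mark (suc ρ) (suc c)
    with D' , st , o , trail , frame ← walk (mark-trace mk) (suc ρ ∸ rank (suc ρ)) {D} {rank (suc ρ)} {suc ρ} {suc c}
           (m∸n+n≡m (rank≤ (suc ρ))) (subst (1 ≤_) (sym (rank-nonempty ρ n)) (s≤s z≤n))
           (trans (InRow.left d (suc c) ≤-refl) p)
           (λ i j l l' c<j → InRow.clear-right d i j l l' c<j (free-right f c<j))
           (λ i l l' → InRow.clear-left d i (suc c) l (s≤s⁻¹ l') ≤-refl f) =
    D' , st , record
      { above = λ i j l → trans (frame i j (λ (_ , _ , x) → <⇒≱ l x)) (above i j l)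
      ; left = λ j l → trans (off (suc ρ) (<⇒≢ (s≤s l))) (left j (m≤n⇒m≤1+n l))
      ; clear-left = λ i j l l' l'' f' →
          trans (off i (<⇒≢ (s≤s l''))) (clear-left i j l l' (m≤n⇒m≤1+n l'') f')
      ; clear-right = right
      ; ghost⁺ = g⁺
      ; ghost⁻ = g⁻
      }
    where
    open InRow d
    off : ∀ i {j} → j ≢ suc c → D' i j ≡ D i j
    off i ne = frame i _ (λ (e , _) → ne e)
    trace-emp : ∀ {g} → Mark (suc ρ) (suc c) g → Free (suc ρ) (suc c) → g ≡ emp
    trace-emp (marked x) f' = contradiction (free-earlier f' x) 1+n≰n
    trace-emp (unmarked _) _ = refl
    trace-gh : ∀ {g} → Mark (suc ρ) (suc c) g → Cloud (suc ρ) (suc c) → g ≡ gh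
    trace-gh (marked _) _ = refl
    trace-gh (unmarked nx) x = contradiction x nx
    gh-cloud : ∀ {g} → Mark (suc ρ) (suc c) g → g ≡ gh → Cloud (suc ρ) (suc c)
    gh-cloud (marked x) _ = x
    right : ∀ i j → rank (suc ρ) < i → i ≤ suc ρ → c < j → Free (suc ρ) j → D' i j ≡ emp
    right i j l l' c<j f' with m≤n⇒m<n∨m≡n c<j
    ... | inj₁ l'' = trans (off i (λ e → <⇒≢ l'' (sym e))) (clear-right i j l l' l'' f')
    ... | inj₂ refl = trans (trail i l l') (trace-emp mk f')
    g⁺ : ∀ i j → HauntedRow ρ c i j → D' i j ≡ gh
    g⁺ i j (inj₁ h@(k , x , k≤ρ , _)) = trans (off i ne) (ghost⁺ i j (inj₁ h))
      where
      ne : j ≢ suc c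
      ne refl = contradiction (free-earlier f x) (≤⇒≯ k≤ρ)
    g⁺ i j (inj₂ (c<j , x , l , l')) with m≤n⇒m<n∨m≡n c<j
    ... | inj₁ l'' = trans (off i (λ e → <⇒≢ l'' (sym e))) (ghost⁺ i j (inj₂ (l'' , x , l , l')))
    ... | inj₂ refl = trans (trail i l l') (trace-gh mk x)
    weaken : ∀ {i j} → HauntedRow ρ (suc c) i j → HauntedRow ρ c i j
    weaken (inj₁ h) = inj₁ h
    weaken (inj₂ (l , h)) = inj₂ (<⇒≤ l , h)
    g⁻ : ∀ i j → D' i j ≡ gh → HauntedRow ρ c i j
    g⁻ i j e with j ≟ suc c | rank (suc ρ) ≤? i | i ≤? suc ρ
    ... | no ne | _ | _ = weaken (ghost⁻ i j (trans (sym (off i ne)) e))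
    ... | yes refl | no nl | _ =
      weaken (ghost⁻ i j (trans (sym (frame i j (λ (_ , l , _) → nl l))) e))
    ... | yes refl | yes _ | no nl =
      weaken (ghost⁻ i j (trans (sym (frame i j (λ (_ , _ , l) → nl l))) e))
    ... | yes refl | yes l | yes l' with m≤n⇒m<n∨m≡n l
    ...   | inj₂ refl = contradiction e (ord≢gh o)
    ...   | inj₁ l'' =
      inj₂ (≤-refl , gh-cloud mk (trans (sym (trail i l'' l')) e) , l'' , l')

  row-step : ∀ {ρ c D} → Nonempty (suc ρ) → InRow ρ (suc c) D → ∃ λ D' → InKKD D D' × InRow ρ c D'
  row-step {ρ} {c} {D} n d with free? ρ (suc c) | emp⊎present (suc ρ) (suc c)
  -- A column that is not free has no cloud in row `suc ρ` or above. Any cell of this row in it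
  -- stays where it is.
  ... | no nf | _ = D , ε , row-skip d (λ x → nf (inj₂ (suc ρ , x , ≤-refl)))
    (λ i _ _ f → contradiction (free-suc f) nf)
  ... | yes f | inj₂ p = row-walk n d f p
  ... | yes f | inj₁ e = D , ε , row-skip d (λ x → emp≢ord e (cloud⇒present x)) clear
    where
    open InRow d
    clear : ∀ i → rank (suc ρ) < i → i ≤ suc ρ → Free (suc ρ) (suc c) → D i (suc c) ≡ emp
    clear i l l' _ with m≤n⇒m<n∨m≡n l'
    ... | inj₁ l'' = clear-left i (suc c) (<⇒≤ l) (s≤s⁻¹ l'') ≤-refl f
    ... | inj₂ refl = trans (left (suc c) ≤-refl) e

  row-all : ∀ {ρ} c {D} → Nonempty (suc ρ) → InRow ρ c D → ∃ λ D' → InKKD D D' × InRow ρ 0 D'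
  row-all zero {D} n d = D , ε , d
  row-all (suc c) n d with D' , st , d' ← row-step n d
                      with D'' , st' , d'' ← row-all c n d' = D'' , st ◅◅ st' , d''

  row-end : ∀ {ρ D} → InRow ρ 0 D → Done (suc ρ) D
  row-end {ρ} {D} d = record
    { above = above
    ; clear = clear
    ; ghost⁺ = g⁺
    ; ghost⁻ = g⁻
    }
    where
    open InRow d
    col≥1 : ∀ {j} → Free (suc ρ) j → 1 ≤ j
    col≥1 (inj₁ l) = m<n⇒0<n l
    col≥1 (inj₂ (_ , x , _)) = cloud-col≥1 x
    clear : ∀ i j → rank (suc ρ) < i → i ≤ suc ρ → Free (suc ρ) j → D i j ≡ emp
    clear i j l l' f = clear-right i j l l' (col≥1 f) f
    g⁺ : ∀ i j → Haunted (suc ρ) i j → D i j ≡ gh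
    g⁺ i j (k , x , l , h) with m≤n⇒m<n∨m≡n l
    ... | inj₁ l' = ghost⁺ i j (inj₁ (k , x , s≤s⁻¹ l' , h))
    ... | inj₂ refl = ghost⁺ i j (inj₂ (cloud-col≥1 x , x , h))
    g⁻ : ∀ i j → D i j ≡ gh → Haunted (suc ρ) i j
    g⁻ i j e with ghost⁻ i j e
    ... | inj₁ (k , x , l , h) = k , x , m≤n⇒m≤1+n l , h
    ... | inj₂ (_ , x , h) = suc ρ , x , ≤-refl , h

  done-empty : ∀ {ρ D} → nonempty (suc ρ) ≡ false → Done ρ D → Done (suc ρ) D
  done-empty {ρ} {D} ne d = record
    { above = λ i j l → above i j (<⇒≤ l)
    ; clear = clear'
    ; ghost⁺ = g⁺
    ; ghost⁻ = λ i j e → let k , x , l , h = ghost⁻ i j e in k , x , m≤n⇒m≤1+n l , h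
    }
    where
    open Done d
    clear' : ∀ i j → rank (suc ρ) < i → i ≤ suc ρ → Free (suc ρ) j → D i j ≡ emp
    clear' i j l l' f with m≤n⇒m<n∨m≡n l'
    ... | inj₁ l'' = clear i j (≤-<-trans (rank-step ρ) l) (s≤s⁻¹ l'') (free-suc f)
    ... | inj₂ refl = trans (above i j ≤-refl)
      (absent⇒emp i j (λ p → true≢false (present⇒nonempty i j p) ne))
    g⁺ : ∀ i j → Haunted (suc ρ) i j → D i j ≡ gh
    g⁺ i j (k , x , l , h) with m≤n⇒m<n∨m≡n l
    ... | inj₁ l' = ghost⁺ i j (k , x , s≤s⁻¹ l' , h)
    ... | inj₂ refl = contradiction ne (true≢false (cloud⇒nonempty x))

  done-start : Done 0 D₀
  done-start = record
    { above = λ _ _ _ → refl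
    ; clear = λ _ _ l l' _ → contradiction l' (<⇒≱ l)
    ; ghost⁺ = λ { _ _ (_ , _ , z≤n , l , l') → contradiction l' (<⇒≱ l) }
    ; ghost⁻ = λ i j e → ⊥-elim (no-ghost i j e)
    }

  done-reachable : ∀ ρ → ∃ λ D → InKKD D₀ D × Done ρ D
  done-reachable zero = D₀ , ε , done-start
  done-reachable (suc ρ) with D , st , d ← done-reachable ρ with nonempty (suc ρ) in eq
  ... | false = D , st , done-empty eq d
  ... | true with D' , st' , d' ← row-all W eq (row-start eq d) = D' , st ◅◅ st' , row-end d'

  -- Counting snowflakes and slots cloud by cloud.

  slots-column : ∀ {k c x} → x ∈ slots (k , c) → proj₂ x ≡ c
  slots-column x∈ with _ , _ , refl ← ∈-map⁻ _ x∈ = refl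

  unique-targets : Unique targets
  unique-targets = concat⁺
    (All.map⁺ (universal (λ (k , c) → map⁺
      (λ e → +-cancelˡ-≡ (rank k) _ _ (suc-injective (cong proj₁ e))) (upTo⁺ (k ∸ rank k))) _))
    (AllPairs.map⁺ (AllPairs.map
      (λ { {(k , c)} {(k' , c')} ne (x∈ , x∈') → ne (trans (sym (slots-column {k} x∈)) (slots-column {k'} x∈')) })
      (clouds-distinct-columns D₀ W H [])))

  -- `snowflake*ᵇ` with the list of clouds made a parameter, for induction on that list.
  snow : List (ℕ × ℕ) → ℕ → ℕ → Bool
  snow ps r c =
    (isEmp (D₀ r c) ∧ any (λ p → (proj₂ p ≡ᵇ c) ∧ (r <ᵇ proj₁ p)) ps) ∧ not (nonempty r)

  emptyBelow : ℕ → ℕ → Bool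
  emptyBelow k r = not (nonempty r) ∧ (r <ᵇ k)

  empty-row : ∀ {r} c → nonempty r ≡ false → isEmp (D₀ r c) ≡ true
  empty-row {r} c e with emp⊎present r c
  ... | inj₁ x = cong isEmp x
  ... | inj₂ p = contradiction e (true≢false (present⇒nonempty r c p))

  uncovered : ∀ {c r ps} → All (λ p → c ≢ proj₂ p) ps →
    any (λ p → (proj₂ p ≡ᵇ c) ∧ (r <ᵇ proj₁ p)) ps ≡ false
  uncovered [] = refl
  uncovered {c} {ps = (k , d) ∷ _} (ne ∷ a) with d ≡ᵇ c in e
  ... | true = contradiction (sym (≡ᵇ⇒≡ d c (≡true⇒T e))) ne
  ... | false = uncovered a

  -- The new cloud is alone in its column, so its snow overlaps no other. In a row that counts,
  -- which is empty, the test `isEmp` always succeeds.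
  snow-cons : ∀ {k d ps} r c → All (λ p → d ≢ proj₂ p) ps →
    bit (snow ((k , d) ∷ ps) r c) ≡ δ d (bit (emptyBelow k r)) c + bit (snow ps r c)
  snow-cons {k} {d} {ps} r c a with nonempty r in e
  ... | true rewrite ∧-zeroʳ (isEmp (D₀ r c) ∧ any (λ p → (proj₂ p ≡ᵇ c) ∧ (r <ᵇ proj₁ p)) ps)
                   | ∧-zeroʳ (isEmp (D₀ r c) ∧ (((d ≡ᵇ c) ∧ (r <ᵇ k)) ∨ any (λ p → (proj₂ p ≡ᵇ c) ∧ (r <ᵇ proj₁ p)) ps))
                   with d ≡ᵇ c
  ...   | true = refl
  ...   | false = refl
  snow-cons {k} {d} {ps} r c a | false rewrite empty-row {r} c e with d ≡ᵇ c in e'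
  ... | false = refl
  ... | true with refl ← ≡ᵇ⇒≡ d c (≡true⇒T e') rewrite uncovered {d} {r} a with r <ᵇ k
  ...   | true = refl
  ...   | false = refl

  -- Each row up to `n` is counted once: by the sum if it is empty, by `rank` otherwise.
  ∑-emptyBelow : ∀ k n → n < k → ∑ (λ r → bit (emptyBelow k r)) n + rank n ≡ n
  ∑-emptyBelow k zero l = refl
  ∑-emptyBelow k (suc n) l with ∑-emptyBelow k n (<⇒≤ l) | nonempty (suc n)
  ... | ih | true = trans (cong (_+ suc (rank n)) (+-identityʳ _)) (trans (+-suc _ (rank n)) (cong suc ih))
  ... | ih | false rewrite T⇒≡true (<⇒<ᵇ l) =
    trans (cong (_+ rank n) (+-comm _ 1)) (cong suc ih)

  ∑-emptyBelow-cloud : ∀ k n → Nonempty k → k ≤ n →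
    ∑ (λ r → bit (emptyBelow k r)) n ≡ k ∸ rank k
  ∑-emptyBelow-cloud zero n ne l = ∑-zero n λ i _ _ → cong bit (∧-zeroʳ (not (nonempty i)))
  ∑-emptyBelow-cloud (suc k) (suc n) ne l with m≤n⇒m<n∨m≡n l
  -- Row `suc k` is nonempty and adds nothing to the sum, while `suc k ∸ suc (rank k)` reduces to
  -- `k ∸ rank k`.
  ... | inj₂ refl rewrite ne = trans (+-identityʳ _) (trans
    (sym (m+n∸n≡m _ (rank k))) (cong (_∸ rank k) (∑-emptyBelow (suc k) k ≤-refl)))
  ... | inj₁ l' = trans (cong₂ _+_ (∑-emptyBelow-cloud (suc k) n ne (s≤s⁻¹ l')) (cong bit beyond))
      (+-identityʳ _)
    where
    beyond : emptyBelow (suc k) (suc n) ≡ false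
    beyond with suc n <ᵇ suc k in e
    ... | true = contradiction (<ᵇ⇒< (suc n) (suc k) (≡true⇒T e)) (<⇒≯ l')
    ... | false = ∧-zeroʳ _

  count-slots : ∀ ps → AllPairs (λ p q → proj₂ p ≢ proj₂ q) ps →
    (∀ {k c} → (k , c) ∈ ps → Cloud k c) →
    ∑ (λ r → ∑ (λ c → bit (snow ps r c)) W) H ≡ length (concat (map slots ps))
  count-slots [] _ _ = ∑-zero H λ r _ _ → ∑-zero W λ c _ _ →
    cong (λ b → bit (b ∧ not (nonempty r))) (∧-zeroʳ (isEmp (D₀ r c)))
  count-slots ((k , d) ∷ ps) (a ∷ as) h = begin
    ∑ (λ r → ∑ (λ c → bit (snow ((k , d) ∷ ps) r c)) W) H
      ≡⟨ ∑-cong H (λ r _ _ → trans (∑-cong W (λ c _ _ → snow-cons {k} {d} {ps} r c a))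
           (trans (∑-+ (δ d (bit (emptyBelow k r))) (λ c → bit (snow ps r c)) W)
             (cong (_+ ∑ (λ c → bit (snow ps r c)) W)
               (∑-δ (bit (emptyBelow k r)) W (cloud-col≥1 (h (here refl))) (cloud-col≤W (h (here refl))))))) ⟩
    ∑ (λ r → bit (emptyBelow k r) + ∑ (λ c → bit (snow ps r c)) W) H
      ≡⟨ ∑-+ (λ r → bit (emptyBelow k r)) (λ r → ∑ (λ c → bit (snow ps r c)) W) H ⟩
    ∑ (λ r → bit (emptyBelow k r)) H + ∑ (λ r → ∑ (λ c → bit (snow ps r c)) W) H
      ≡⟨ cong₂ _+_
           (∑-emptyBelow-cloud k H (cloud⇒nonempty (h (here refl)))
             (present⇒row≤H k d (cloud⇒present (h (here refl)))))
           (count-slots ps as (λ x → h (there x))) ⟩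
    (k ∸ rank k) + length (concat (map slots ps))
      ≡⟨ cong (_+ length (concat (map slots ps)))
           (sym (trans (length-map _ (upTo (k ∸ rank k))) (length-upTo (k ∸ rank k)))) ⟩
    length (slots (k , d)) + length (concat (map slots ps))
      ≡⟨ length-++ (slots (k , d)) ⟨
    length (concat (map slots ((k , d) ∷ ps))) ∎
    where open ≡-Reasoning

  numSnow*≡ : numSnow* H W D₀ ≡ length targets
  numSnow*≡ = trans (sum-range _ H)
    (trans (∑-cong H (λ r _ _ → trans (count-map (snowflake*ᵇ H W D₀ r) (map suc (upTo W))) (sum-range _ W)))
      (count-slots (darkClouds H W D₀) (clouds-distinct-columns D₀ W H []) (λ x → x)))

  -- The hypothesis on cloudless rows, and the two bounds combined.

  -- The zero-based position in the list of nonempty rows is the rank less one. For the induction,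
  -- `f` enumerates the rows after row `o`, so ranks are taken relative to `rank o`.
  nonempty-index : ∀ {f} o n → (∀ i → f i ≡ suc (o + i)) → ∀ {x} → o < x → x ≤ o + n → Nonempty x →
    let rs = filter (λ r → nonempty r Bool.≟ true) (applyUpTo f n) in
    ∃ λ (k : Fin (length rs)) → List.lookup rs k ≡ x × suc (toℕ k) + rank o ≡ rank x
  nonempty-index o zero _ {x} l l' _ = contradiction (subst (x ≤_) (+-identityʳ o) l') (<⇒≱ l)
  nonempty-index {f} o (suc n) eq {x} l l' ne
    with nonempty (f 0) in e | m≤n⇒m<n∨m≡n l
  ... | true | inj₂ refl = Fin.zero , first , sym (rank-nonempty o ne)
    where
    first : f 0 ≡ suc o
    first = trans (eq 0) (cong suc (+-identityʳ o))
  ... | false | inj₂ refl = contradiction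
    (trans (sym (cong nonempty (trans (eq 0) (cong suc (+-identityʳ o))))) e) (true≢false ne)
  ... | true | inj₁ l''
    with k , p , q ← nonempty-index (suc o) n (λ i → trans (eq (suc i)) (cong suc (+-suc o i)))
           l'' (subst (x ≤_) (+-suc o n) l') ne =
    Fin.suc k , p , trans (sym (+-suc (suc (toℕ k)) (rank o)))
      (trans (cong (suc (toℕ k) +_) (sym (rank-nonempty o first))) q)
    where
    first : nonempty (suc o) ≡ true
    first = trans (sym (cong nonempty (trans (eq 0) (cong suc (+-identityʳ o))))) e
  ... | false | inj₁ l''
    with k , p , q ← nonempty-index (suc o) n (λ i → trans (eq (suc i)) (cong suc (+-suc o i)))
           l'' (subst (x ≤_) (+-suc o n) l') ne =
    k , p , trans (cong (suc (toℕ k) +_) (sym (rank-empty o first))) q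
    where
    first : nonempty (suc o) ≡ false
    first = trans (sym (cong nonempty (trans (eq 0) (cong suc (+-identityʳ o))))) e

  Bad : ℕ → Set
  Bad ρ = Nonempty ρ × rank ρ < ρ × ¬ (∃ λ c → Cloud ρ c)

  row-cloud? : ∀ ρ → Dec (∃ λ c → Cloud ρ c)
  row-cloud? ρ = map′ from to (any? (λ p → proj₁ p ≟ ρ) (darkClouds H W D₀))
    where
    from : Any (λ p → proj₁ p ≡ ρ) (darkClouds H W D₀) → ∃ λ c → Cloud ρ c
    from a with (_ , c) , x , refl ← find a = c , x
    to : (∃ λ c → Cloud ρ c) → Any (λ p → proj₁ p ≡ ρ) (darkClouds H W D₀)
    to (_ , x) = lose x refl

  bad? : ∀ ρ → Dec (Bad ρ)
  bad? ρ = (nonempty ρ Bool.≟ true) ×-dec (rank ρ <? ρ) ×-dec ¬? (row-cloud? ρ)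

  bad-index : ∀ {ρ} → Bad ρ → let rs = nonemptyRows H W D₀ in
    ∃ λ (k : Fin (length rs)) → List.lookup rs k ≡ ρ ×
      suc (toℕ k) < List.lookup rs k × NoCloudInRow H W D₀ (List.lookup rs k)
  bad-index {ρ} (ne , l , nc) with nonempty⇒bounds ρ ne
  ... | 1≤ρ , ρ≤H
    with nonempty-index {suc} 0 H (λ _ → refl) 1≤ρ ρ≤H ne
  ... | index rewrite sym (map-upTo suc H) with k , refl , q ← index =
    k , refl , subst (_< ρ) (trans (sym q) (+-identityʳ _)) l , λ c x → nc (c , x)

  bad-unique : AtMostOneBad H W D₀ → ∀ {ρ ρ'} → Bad ρ → Bad ρ' → ρ ≡ ρ'
  bad-unique once b b' with k , refl , l , n ← bad-index b | k' , refl , l' , n' ← bad-index b' =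
    cong (List.lookup (nonemptyRows H W D₀)) (once k k' l n l' n')

  cloud-unless-bad : ∀ ρ → Nonempty ρ → rank ρ < ρ → ¬ Bad ρ → ∃ λ c → Cloud ρ c
  cloud-unless-bad ρ ne l nb with row-cloud? ρ
  ... | yes x = x
  ... | no nx = contradiction (ne , l , nx) nb

  ghost-bound : AtMostOneBad H W D₀ → ∀ D k → InKKD D₀ D → GhostCount D k → k ≤ length targets
  ghost-bound once D k st gc with _ , _ , L ← labelled-reachable labelled-start st
    with anyUpTo? bad? (suc H)
  ... | yes (B , _ , bad) = Bound.ghosts≤targets L B
      (λ ρ ne l ρ<B → cloud-unless-bad ρ ne l (λ b → <⇒≢ ρ<B (bad-unique once b bad)))
      -- `rank<-upward` carries `rank B < B` up to `ρ`, so a cloudless nonempty row above `B` would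
      -- be a second bad row.
      (λ ρ ne B<ρ → cloud-unless-bad ρ ne (rank<-upward (proj₁ (proj₂ bad)) (<⇒≤ B<ρ))
        (λ b → <⇒≢ B<ρ (bad-unique once bad b)))
      k gc
  -- With `B = suc H` the condition above `B` is vacuous, as every nonempty row is at most `H`.
  ... | no none = Bound.ghosts≤targets L (suc H)
      (λ ρ ne l ρ≤H → cloud-unless-bad ρ ne l (λ b → none (ρ , ρ≤H , b)))
      (λ ρ ne H<ρ → contradiction (proj₂ (nonempty⇒bounds ρ ne)) (<⇒≱ (<-trans ≤-refl H<ρ)))
      k gc

  ghosts-attained : ∃ λ D → InKKD D₀ D × GhostCount D (length targets)
  ghosts-attained with D , st , d ← done-reachable H =
    D , st , targets , unique-targets , (λ i j → to i j , from i j) , refl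
    where
    open Done d
    to : ∀ i j → (i , j) ∈ targets → D i j ≡ gh
    to i j x with k , cl , l , l' ← ∈-targets⁻ x =
      ghost⁺ i j (k , cl , present⇒row≤H k j (cloud⇒present cl) , l , l')
    from : ∀ i j → D i j ≡ gh → (i , j) ∈ targets
    from i j e with k , cl , _ , l , l' ← ghost⁻ i j e = ∈-targets⁺ cl l l'

theorem3p17 : (α : List ℕ) →
    AtMostOneBad (length α) (maxList α) (lock α) →
    MaxGIs (lock α) (numSnow* (length α) (maxList α) (lock α))
theorem3p17 α once = subst (MaxGIs (lock α)) (sym numSnow*≡) (ghosts-attained , ghost-bound once)
  where open Lock α
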